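{- Let $G$ be a finite (unsigned) graph. Write its chromatic symmetric function $X_G$ as a polynomial with rational coefficients in $\{\zeta_n : n\ge1\}$. Then for every $k\ge 0$, the number of acyclic orientations of $G$ with exactly $k$ sinks equals the sum of the coefficients of those monomials for which the sum of the indices $n$ of its $\zeta_n$ factors (counted with multiplicity) equals $k$.
   Context: For a finite graph $G$ with vertices $v_1,\dots,v_n$, a proper coloring is a map $\kappa:V(G)\to\{1,2,3,\dots\}$ with $\kappa(u)\ne\kappa(v)$ whenever $u,v$ are joined by an edge, and $X_G=\sum_{\kappa\text{ proper}}x_{\kappa(v_1)}\cdots x_{\kappa(v_n)}$ in commuting variables $x_1,x_2,\dots$. A sink of an orientation is a vertex with no outgoing edges. Notation: $p_a=\sum_{i\ge1}x_i^a$ and $\zeta_n=\sum_{a=1}^n\binom{n}{a}p_a$ for $n\ge1$ (equivalently $p_n=\sum_{i=1}^n\binom{n}{i}(-1)^{n-i}\zeta_i$). -}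

module Defs where

open import Data.Bool.Base using (Bool; true; false; if_then_else_)
open import Data.Fin.Base using (Fin)
import Data.Fin.Properties as Fin
open import Data.Integer.Base using (+_)
open import Data.List.Base as List
  using (List; []; _∷_; [_]; allFin; cartesianProductWith; filter; foldr; length; map; upTo)
open import Data.List.Membership.Propositional using () renaming (_∈_ to _∈ˡ_)
open import Data.List.Membership.Propositional.Properties using (∈-allFin)
open import Data.List.Relation.Unary.Any using (here; there)
open import Data.Nat.Base as ℕ using (ℕ; suc; _∸_; NonZero)
open import Data.Nat.Combinatorics using (_C_)
import Data.Nat.Properties as ℕ
open import Data.Product.Base using (_×_; _,_; proj₁; proj₂)
open import Data.Product.Properties using (≡-dec)
open import Data.Rational.Base as ℚ using (ℚ; 0ℚ; 1ℚ)
open import Data.Sum.Base using (_⊎_; inj₁; inj₂)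
open import Data.Vec.Base as Vec using (Vec; lookup; replicate; tabulate; zipWith; _[_]≔_)
import Data.Vec.Membership.DecPropositional as VecMembership
import Data.Vec.Properties as Vec
open import Data.Vec.Relation.Unary.All using (All; all?)
open import Relation.Binary.Construct.Closure.Transitive as Plus using (TransClosure)
open import Relation.Binary.Core using (Rel)
open import Relation.Binary.Definitions using () renaming (Decidable to Decidable₂)
open import Relation.Binary.PropositionalEquality using (_≡_; _≢_; refl)
open import Relation.Nullary.Decidable using (Dec; does; map′; ¬?; _×-dec_; _⊎-dec_)
open import Relation.Nullary.Negation using (¬_)
open import Level using (0ℓ)

fromℕ : ℕ → ℚ
fromℕ n = + n ℚ./ 1

sumℚ : List ℚ → ℚ
sumℚ = foldr ℚ._+_ 0ℚ

-- All vectors of length n with entries taken from a list; each vector occurs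
-- exactly once when the list has no repetitions.
allVecs : {A : Set} → List A → (n : ℕ) → List (Vec A n)
allVecs as ℕ.zero  = [ Vec.[] ]
allVecs as (suc n) = cartesianProductWith Vec._∷_ as (allVecs as n)

------------------------------------------------------------------------
-- Formal power series over ℚ in countably many commuting variables

-- e : Exponent m is the monomial in which the first m variables have the
-- exponents listed in e and no other variable occurs.  Every monomial has this
-- form for all large m.
Exponent : ℕ → Set
Exponent = Vec ℕ

_≟ᵉ_ : ∀ {m} (e f : Exponent m) → Dec (e ≡ f)
_≟ᵉ_ = Vec.≡-dec ℕ._≟_

-- A series is its family of coefficients.
Series : Set
Series = (m : ℕ) → Exponent m → ℚ

infix  4 _≈_
infixl 6 _⊕_
infixl 7 _⊗_ _·_

_≈_ : Series → Series → Set
f ≈ g = ∀ m e → f m e ≡ g m e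

𝟘 : Series
𝟘 m e = 0ℚ

𝟙 : Series
𝟙 m e = if does (e ≟ᵉ replicate m 0) then 1ℚ else 0ℚ

_⊕_ : Series → Series → Series
(f ⊕ g) m e = f m e ℚ.+ g m e

_·_ : ℚ → Series → Series
(c · f) m e = c ℚ.* f m e

-- All ways of writing a monomial as a product of two monomials.
splits : ∀ {m} → Exponent m → List (Exponent m × Exponent m)
splits Vec.[]       = [ Vec.[] , Vec.[] ]
splits (a Vec.∷ e) =
  cartesianProductWith (λ i (α , β) → (i Vec.∷ α , (a ∸ i) Vec.∷ β))
                       (upTo (suc a)) (splits e)

_⊗_ : Series → Series → Series
(f ⊗ g) m e = sumℚ (map (λ (α , β) → f m α ℚ.* g m β) (splits e))

-- The power sum Σᵢ xᵢᵃ.  For a ≥ 1 the variables beyond the first m contribute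
-- nothing to the coefficient of a monomial in the first m; only a ≥ 1 is used.
p : ℕ → Series
p a m e =
  fromℕ (length (filter (λ i → e ≟ᵉ (replicate m 0 [ i ]≔ a)) (allFin m)))

ζ : ℕ → Series
ζ n = foldr _⊕_ 𝟘 (map (λ a → fromℕ (n C suc a) · p (suc a)) (upTo n))

------------------------------------------------------------------------
-- Polynomials over ℚ in the indeterminates ζ₁, ζ₂, …

record Index : Set where
  constructor mkIndex
  field
    value       : ℕ
    .{{nonZero}} : NonZero value

open Index public

Monomial : Set
Monomial = List Index

-- A formal sum of terms.  The same monomial may occur in several terms (also
-- with its factors in another order); its coefficient is then the sum of
-- theirs.
Polynomial : Set
Polynomial = List (ℚ × Monomial)

indexSum : Monomial → ℕ
indexSum μ = foldr ℕ._+_ 0 (map value μ)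

coefficientSum : ℕ → Polynomial → ℚ
coefficientSum k P =
  sumℚ (map proj₁ (filter (λ (_ , μ) → indexSum μ ℕ.≟ k) P))

evalMonomial : Monomial → Series
evalMonomial μ = foldr _⊗_ 𝟙 (map (λ n → ζ (value n)) μ)

eval : Polynomial → Series
eval P = foldr _⊕_ 𝟘 (map (λ (c , μ) → c · evalMonomial μ) P)

------------------------------------------------------------------------
-- Transitive closure of a decidable relation on Fin n is decidable

module Reachability {n : ℕ} {_⟶_ : Rel (Fin n) 0ℓ} (_⟶?_ : Decidable₂ _⟶_) where

  private
    -- Walks whose interior vertices lie in ws (Warshall's algorithm).
    Via : List (Fin n) → Rel (Fin n) 0ℓ
    Via []       u v = u ⟶ v
    Via (w ∷ ws) u v = Via ws u v ⊎ (Via ws u w × Via ws w v)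

    via? : ∀ ws → Decidable₂ (Via ws)
    via? []       u v = u ⟶? v
    via? (w ∷ ws) u v = via? ws u v ⊎-dec (via? ws u w ×-dec via? ws w v)

    sound : ∀ ws {u v} → Via ws u v → TransClosure _⟶_ u v
    sound []       r              = Plus.[ r ]
    sound (w ∷ ws) (inj₁ r)       = sound ws r
    sound (w ∷ ws) (inj₂ (r , s)) = sound ws r Plus.++ sound ws s

    to : ∀ w ws {u} → Via (w ∷ ws) u w → Via ws u w
    to w ws (inj₁ r)       = r
    to w ws (inj₂ (r , _)) = r

    from : ∀ w ws {v} → Via (w ∷ ws) w v → Via ws w v
    from w ws (inj₁ r)       = r
    from w ws (inj₂ (_ , s)) = s

    compose : ∀ ws {u x v} → x ∈ˡ ws → Via ws u x → Via ws x v → Via ws u v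
    compose (w ∷ ws) (here refl) r s = inj₂ (to w ws r , from w ws s)
    compose (w ∷ ws) (there x∈)  (inj₁ r) (inj₁ s) = inj₁ (compose ws x∈ r s)
    compose (w ∷ ws) (there x∈)  (inj₁ r) (inj₂ (s , t)) =
      inj₂ (compose ws x∈ r s , t)
    compose (w ∷ ws) (there x∈)  (inj₂ (q , r)) (inj₁ s) =
      inj₂ (q , compose ws x∈ r s)
    compose (w ∷ ws) (there x∈)  (inj₂ (q , _)) (inj₂ (_ , t)) = inj₂ (q , t)

    step : ∀ ws {u v} → u ⟶ v → Via ws u v
    step []       r = r
    step (w ∷ ws) r = inj₁ (step ws r)

    complete : ∀ {u v} → TransClosure _⟶_ u v → Via (allFin n) u v
    complete Plus.[ r ]     = step (allFin n) r
    complete (r Plus.∷ r⁺) =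
      compose (allFin n) (∈-allFin _) (step (allFin n) r) (complete r⁺)

  reachable? : Decidable₂ (TransClosure _⟶_)
  reachable? u v = map′ (sound (allFin n)) complete (via? (allFin n) u v)

------------------------------------------------------------------------
-- Graphs

-- A finite graph, loops and multiple edges allowed.  Each edge is recorded by
-- its two ends; their order serves only as a reference direction.
record Graph : Set where
  constructor mkGraph
  field
    order : ℕ
    size  : ℕ
    edges : Vec (Fin order × Fin order) size

module _ (G : Graph) where
  open Graph G

  Vertex : Set
  Vertex = Fin order

  Coloring : ℕ → Set
  Coloring m = Vec (Fin m) order

  Proper : ∀ {m} → Coloring m → Set
  Proper κ = All (λ (u , v) → lookup κ u ≢ lookup κ v) edges

  proper? : ∀ {m} (κ : Coloring m) → Dec (Proper κ)
  proper? κ = all? (λ (u , v) → ¬? (lookup κ u Fin.≟ lookup κ v)) edges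

  -- The monomial ∏ᵥ x_{κ(v)}.
  content : ∀ {m} → Coloring m → Exponent m
  content κ = tabulate (λ c → Vec.count (Fin._≟ c) κ)

  -- A coloring by positive integers whose monomial involves only the first m
  -- variables uses only the first m colors, so the coefficient at such a
  -- monomial counts colorings by Fin m.
  X : Series
  X m e = fromℕ (length (filter (λ κ → proper? κ ×-dec (content κ ≟ᵉ e))
                                (allVecs (allFin m) order)))

  -- true keeps the reference direction of an edge, false reverses it.
  Orientation : Set
  Orientation = Vec Bool size

  orientations : List Orientation
  orientations = allVecs (true ∷ false ∷ []) size

  orient : Bool → Vertex × Vertex → Vertex × Vertex
  orient true  (u , v) = u , v
  orient false (u , v) = v , u

  open VecMembership (≡-dec (Fin._≟_ {order}) (Fin._≟_ {order})) using (_∈_; _∈?_)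

  Arrow : Orientation → Rel Vertex 0ℓ
  Arrow o u v = (u , v) ∈ zipWith orient o edges

  arrow? : ∀ o → Decidable₂ (Arrow o)
  arrow? o u v = (u , v) ∈? zipWith orient o edges

  Acyclic : Orientation → Set
  Acyclic o = ∀ v → ¬ TransClosure (Arrow o) v v

  acyclic? : ∀ o → Dec (Acyclic o)
  acyclic? o = Fin.all? (λ v → ¬? (Reachability.reachable? (arrow? o) v v))

  Sink : Orientation → Vertex → Set
  Sink o u = ∀ v → ¬ Arrow o u v

  sink? : ∀ o u → Dec (Sink o u)
  sink? o u = Fin.all? (λ v → ¬? (arrow? o u v))

  sinkCount : Orientation → ℕ
  sinkCount o = length (filter (sink? o) (allFin order))

  -- Number of acyclic orientations with exactly k sinks.
  acyclicWithSinks : ℕ → ℕ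
  acyclicWithSinks k =
    length (filter (λ o → acyclic? o ×-dec (sinkCount o ℕ.≟ k)) orientations)

{-# OPTIONS --safe #-}
module Submission where

-- Substitute (x, -1, …, -1) with m entries -1 and let t = 1 + x.  Then ζₙ becomes
-- tⁿ - (m + 1), which at m = -1 is tⁿ, so for X_G = P(ζ₁, ζ₂, …) the value of P at
-- m = -1 is Σₖ cₖ tᵏ with cₖ the sum of the coefficients of index sum k.  On the other
-- side, X_G becomes Σ_S x^|S| (-1)^|V∖S| χ_{V∖S}(m) over the stable sets S (the vertices
-- with the first color).  At m = -1 Stanley's reciprocity turns this into Σ_S x^|S| a(V∖S)
-- with a counting acyclic orientations.  An acyclic orientation of V∖S extends uniquely
-- to one of G in which all of S are sinks, so the sum is Σ_o (1 + x)^(number of sinks of o).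
--
-- Reciprocity follows from the same bijection: at x = -1 it gives
-- Σ_S (-1)^|S| a(W∖S) = [W = ∅], which is the recursion of (-1)^|W| χ_W at -1.
--
-- That X_G is a polynomial in the ζₙ is deletion-contraction for graphs with weighted
-- vertices, where an isolated vertex of weight a contributes the factor pₐ.

open import Defs
open import Algebra.Bundles using (CommutativeRing)
open import Data.Bool.Base using (Bool; true; false; if_then_else_; _∧_; _∨_; not; T)
open import Data.Bool.ListAction using (all)
import Data.Bool.Properties as Bool
open import Data.Empty using (⊥; ⊥-elim)
open import Data.Fin.Base as Fin using (Fin)
import Data.Fin.Properties as Fin
import Data.Integer.Base as ℤ
import Data.Integer.Properties as ℤ
open import Data.List.Base as List
  using (List; []; _∷_; [_]; _++_; allFin; cartesianProductWith; deduplicate; filter; filterᵇ; foldr; length; map; upTo)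
open import Data.List.Membership.Propositional using () renaming (_∈_ to _∈ˡ_)
import Data.List.Membership.DecPropositional as ListMembership
import Data.List.Membership.Propositional.Properties as ∈ˡ
import Data.List.Properties as List
open import Data.List.Relation.Unary.All as Allˡ using () renaming (All to Allˡ)
open import Data.List.Relation.Unary.AllPairs using ([]; _∷_)
open import Data.List.Relation.Unary.Any using (here; there)
open import Data.List.Relation.Unary.Unique.Propositional using (Unique)
import Data.List.Relation.Unary.Unique.DecPropositional.Properties as UniqueDec
import Data.List.Relation.Unary.Unique.Propositional.Properties as Unique
open import Data.Maybe.Base as Maybe using (Maybe; just; nothing)
open import Data.Nat using (ℕ)
open import Data.Nat.Base as ℕ using (zero; suc; _∸_; _≤_; _<_; s≤s; z≤n)
open import Data.Nat.Combinatorics using (_C_; nCk+nC[k+1]≡[n+1]C[k+1]; nCn≡1; k>n⇒nCk≡0)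
import Data.Nat.Properties as ℕ
open import Data.Product using (∃-syntax; _×_; _,_; proj₁; proj₂)
open import Data.Product.Properties using (≡-dec)
open import Data.Rational.Base using (ℚ; 0ℚ; 1ℚ; _+_; _*_; -_; _-_)
import Data.Rational.Base as ℚ
open import Data.Rational.Properties
open import Data.Rational.Solver using (module +-*-Solver)
import Data.Rational.Unnormalised.Base as ℚᵘ
import Data.Rational.Unnormalised.Properties as ℚᵘ
open import Data.Sum.Base as Sum using (_⊎_; inj₁; inj₂)
open import Data.Vec.Base as Vec using (Vec; []; _∷_; lookup; replicate; tabulate; zipWith; _[_]≔_)
import Data.Vec.Membership.Propositional.Properties as VecMembership
import Data.Vec.Properties as Vec
import Data.Vec.Relation.Unary.All as VecAll
open import Function.Base using (_∘_; id)
open import Function.Bundles using (mk⇔)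
open import Relation.Binary.Construct.Closure.Transitive as Plus using (TransClosure)
open import Relation.Binary.Definitions using (DecidableEquality)
open import Relation.Binary.PropositionalEquality
  using (_≡_; refl; sym; trans; cong; cong₂; subst; module ≡-Reasoning)
open import Relation.Nullary.Decidable using (Dec; yes; no; does; does-⇔; dec-true; dec-false; _×-dec_; ¬?; T?)
open import Relation.Nullary.Negation using (¬_)
open import Algebra.Definitions.RawSemiring +-*-rawSemiring using (_^_)
open import Algebra.Properties.Group +-0-group using () renaming (∙-cancelˡ to +-cancelˡ)
open import Algebra.Properties.Semiring.Exp (CommutativeRing.semiring +-*-commutativeRing)
  using (^-homo-*)

-- A point cannot have -1 entries equal to -1. Both values are therefore read as sequences in k = m
-- + 1, known to agree for k ≥ 1; each is a polynomial in k, and the agreement is extrapolated one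
-- step back to k = 0. On the coloring side the entry at k = 0 is defined by acyclic counts, so
-- reciprocity becomes the statement that the extended sequence is still polynomial. Polynomiality
-- means that an iterated difference vanishes, which suits this: the recursion over stable sets
-- expresses a difference through smaller vertex sets. The entry -1 is chosen because 1 + (-1) = 0:
-- each such variable adds 0ⁿ - 1 = -1 to ζₙ, whatever n ≥ 1 is. The comparison works with an
-- arbitrary P representing X_G; the existence of some P is a separate argument.

fromℕ-+ : ∀ a b → fromℕ (a ℕ.+ b) ≡ fromℕ a + fromℕ b
-- `fromℕ` normalises its fraction, so the equation is checked among unnormalised fractions, where
-- all denominators are 1.
fromℕ-+ a b = toℚᵘ-injective (begin-equality
  ℚ.toℚᵘ (fromℕ (a ℕ.+ b))                 ≃⟨ toℚᵘ-fromℚᵘ (ℚᵘ.mkℚᵘ (ℤ.+ (a ℕ.+ b)) 0) ⟩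
  ℚᵘ.mkℚᵘ (ℤ.+ (a ℕ.+ b)) 0                  ≃⟨ ℚᵘ.*≡* (cong (ℤ._* ℤ.1ℤ) (cong₂ ℤ._+_ (sym (ℤ.*-identityʳ (ℤ.+ a))) (sym (ℤ.*-identityʳ (ℤ.+ b))))) ⟩
  ℚᵘ.mkℚᵘ (ℤ.+ a) 0 ℚᵘ.+ ℚᵘ.mkℚᵘ (ℤ.+ b) 0     ≃⟨ ℚᵘ.+-cong (toℚᵘ-fromℚᵘ (ℚᵘ.mkℚᵘ (ℤ.+ a) 0)) (toℚᵘ-fromℚᵘ (ℚᵘ.mkℚᵘ (ℤ.+ b) 0)) ⟨
  ℚ.toℚᵘ (fromℕ a) ℚᵘ.+ ℚ.toℚᵘ (fromℕ b)   ≃⟨ toℚᵘ-homo-+ (fromℕ a) (fromℕ b) ⟨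
  ℚ.toℚᵘ (fromℕ a + fromℕ b)               ∎)
  where open ℚᵘ.≤-Reasoning

open ≡-Reasoning
open +-*-Solver using (solve; _:=_; _:+_; _:*_; _:-_; con)

private variable
  A B : Set
  m n : ℕ

-- Finite sums

∑ : List A → (A → ℚ) → ℚ
∑ xs f = sumℚ (map f xs)

⟦_⟧ : Bool → ℚ
⟦ b ⟧ = if b then 1ℚ else 0ℚ

∑-cong-∈ : ∀ {f g : A → ℚ} xs → (∀ x → x ∈ˡ xs → f x ≡ g x) → ∑ xs f ≡ ∑ xs g
∑-cong-∈ []       eq = refl
∑-cong-∈ (x ∷ xs) eq = cong₂ _+_ (eq x (here refl)) (∑-cong-∈ xs (λ y y∈ → eq y (there y∈)))

∑-cong : ∀ {f g : A → ℚ} xs → (∀ x → f x ≡ g x) → ∑ xs f ≡ ∑ xs g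
∑-cong xs eq = ∑-cong-∈ xs (λ x _ → eq x)

∑-0 : ∀ (xs : List A) → ∑ xs (λ _ → 0ℚ) ≡ 0ℚ
∑-0 []       = refl
∑-0 (x ∷ xs) = trans (+-identityˡ _) (∑-0 xs)

∑-+ : ∀ (f g : A → ℚ) xs → ∑ xs (λ x → f x + g x) ≡ ∑ xs f + ∑ xs g
∑-+ f g []       = refl
∑-+ f g (x ∷ xs) = trans (cong (f x + g x +_) (∑-+ f g xs))
  (solve 4 (λ a b c d → (a :+ b) :+ (c :+ d) := (a :+ c) :+ (b :+ d)) refl (f x) (g x) (∑ xs f) (∑ xs g))

∑-*ˡ : ∀ c (f : A → ℚ) xs → ∑ xs (λ x → c * f x) ≡ c * ∑ xs f
∑-*ˡ c f []       = sym (*-zeroʳ c)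
∑-*ˡ c f (x ∷ xs) = trans (cong (c * f x +_) (∑-*ˡ c f xs)) (sym (*-distribˡ-+ c (f x) (∑ xs f)))

∑-*ʳ : ∀ c (f : A → ℚ) xs → ∑ xs (λ x → f x * c) ≡ ∑ xs f * c
∑-*ʳ c f xs = trans (∑-cong xs (λ x → *-comm (f x) c)) (trans (∑-*ˡ c f xs) (*-comm c _))

∑-swap : ∀ (f : A → B → ℚ) xs ys →
         ∑ xs (λ x → ∑ ys (f x)) ≡ ∑ ys (λ y → ∑ xs (λ x → f x y))
∑-swap f []       ys = sym (∑-0 ys)
∑-swap f (x ∷ xs) ys = trans (cong (∑ ys (f x) +_) (∑-swap f xs ys)) (sym (∑-+ (f x) (λ y → ∑ xs (λ x → f x y)) ys))

∑-++ : ∀ (f : A → ℚ) xs ys → ∑ (xs ++ ys) f ≡ ∑ xs f + ∑ ys f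
∑-++ f []       ys = sym (+-identityˡ _)
∑-++ f (x ∷ xs) ys = trans (cong (f x +_) (∑-++ f xs ys)) (sym (+-assoc (f x) (∑ xs f) (∑ ys f)))

∑-map : ∀ (f : B → ℚ) (g : A → B) xs → ∑ (map g xs) f ≡ ∑ xs (f ∘ g)
∑-map f g xs = cong sumℚ (sym (List.map-∘ xs))

∑-cartesian : ∀ {C : Set} (f : C → ℚ) (g : A → B → C) xs ys →
              ∑ (cartesianProductWith g xs ys) f ≡ ∑ xs (λ x → ∑ ys (λ y → f (g x y)))
∑-cartesian f g []       ys = refl
∑-cartesian f g (x ∷ xs) ys =
  trans (∑-++ f (map (g x) ys) _) (cong₂ _+_ (∑-map f (g x) ys) (∑-cartesian f g xs ys))

∑-filter : ∀ {P : A → Set} (P? : ∀ x → Dec (P x)) (f : A → ℚ) xs →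
           ∑ (filter P? xs) f ≡ ∑ xs (λ x → ⟦ does (P? x) ⟧ * f x)
∑-filter P? f []       = refl
∑-filter P? f (x ∷ xs) with does (P? x)
... | true  = cong₂ _+_ (sym (*-identityˡ (f x))) (∑-filter P? f xs)
... | false = trans (∑-filter P? f xs) (sym (trans (cong (_+ _) (*-zeroˡ (f x))) (+-identityˡ _)))

length-filter : ∀ {P : A → Set} (P? : ∀ x → Dec (P x)) xs →
                fromℕ (length (filter P? xs)) ≡ ∑ xs (λ x → ⟦ does (P? x) ⟧)
length-filter P? []       = refl
length-filter P? (x ∷ xs) with does (P? x)
... | true  = trans (fromℕ-+ 1 (length (filter P? xs))) (cong (1ℚ +_) (length-filter P? xs))
... | false = trans (length-filter P? xs) (sym (+-identityˡ _))

⟦∧⟧ : ∀ a b → ⟦ a ∧ b ⟧ ≡ ⟦ a ⟧ * ⟦ b ⟧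
⟦∧⟧ true  b = sym (*-identityˡ _)
⟦∧⟧ false b = sym (*-zeroˡ ⟦ b ⟧)

module _ (_≟_ : DecidableEquality A) where

  ∑-pick-∉ : ∀ a (f : A → ℚ) xs → ¬ a ∈ˡ xs → ∑ xs (λ x → ⟦ does (a ≟ x) ⟧ * f x) ≡ 0ℚ
  ∑-pick-∉ a f xs a∉ = trans (∑-cong-∈ xs eq) (∑-0 xs)
    where
    eq : ∀ x → x ∈ˡ xs → ⟦ does (a ≟ x) ⟧ * f x ≡ 0ℚ
    eq x x∈ rewrite dec-false (a ≟ x) (λ { refl → a∉ x∈ }) = *-zeroˡ (f x)

  ∑-pick : ∀ a (f : A → ℚ) {xs} → Unique xs → a ∈ˡ xs →
           ∑ xs (λ x → ⟦ does (a ≟ x) ⟧ * f x) ≡ f a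
  ∑-pick a f (≢xs ∷ _) (here {xs = xs} refl) rewrite dec-true (a ≟ a) refl =
    trans (cong₂ _+_ (*-identityˡ (f a)) (∑-pick-∉ a f xs (λ a∈ → Allˡ.lookup ≢xs a∈ refl)))
          (+-identityʳ _)
  ∑-pick a f (≢xs ∷ u) (there {x = x} a∈)
    rewrite dec-false (a ≟ x) (λ { refl → Allˡ.lookup ≢xs a∈ refl }) =
    trans (cong (_+ _) (*-zeroˡ (f x))) (trans (+-identityˡ _) (∑-pick a f u a∈))

-- Finitely supported coefficient families and their values at a point

_⊞_ : Exponent m → Exponent m → Exponent m
_⊞_ = zipWith ℕ._+_

δ : Exponent m → Exponent m → ℚ
δ α e = ⟦ does (α ≟ᵉ e) ⟧

-- Only i = x can contribute. Truncated subtraction makes x ≤ a a separate question: if it fails, x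
-- is outside the range and x + y = a is impossible too.
∑-antidiagonal : ∀ x y a →
  ∑ (upTo (suc a)) (λ i → ⟦ does (x ℕ.≟ i) ⟧ * ⟦ does (y ℕ.≟ (a ∸ i)) ⟧) ≡ ⟦ does ((x ℕ.+ y) ℕ.≟ a) ⟧
∑-antidiagonal x y a with x ℕ.≤? a
... | yes x≤a = trans
  (∑-pick ℕ._≟_ x _ (Unique.upTo⁺ (suc a)) (∈ˡ.∈-upTo⁺ (s≤s x≤a)))
  (cong ⟦_⟧ (does-⇔ (mk⇔ (λ { refl → ℕ.m+[n∸m]≡n x≤a }) (λ { refl → sym (ℕ.m+n∸m≡n x y) }))
                    (y ℕ.≟ (a ∸ x)) ((x ℕ.+ y) ℕ.≟ a)))
... | no x≰a = trans
  (∑-pick-∉ ℕ._≟_ x _ (upTo (suc a)) (λ x∈ → x≰a (ℕ.s≤s⁻¹ (∈ˡ.∈-upTo⁻ x∈))))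
  (cong ⟦_⟧ (sym (dec-false ((x ℕ.+ y) ℕ.≟ a) (λ { refl → x≰a (ℕ.m≤m+n x y) }))))

∑-splits-δ : ∀ (α β e : Exponent m) →
             ∑ (splits e) (λ (α′ , β′) → δ α α′ * δ β β′) ≡ δ (α ⊞ β) e
∑-splits-δ [] [] [] = refl
∑-splits-δ (x ∷ α) (y ∷ β) (a ∷ e) = begin
  ∑ (splits (a ∷ e)) (λ (α′ , β′) → δ (x ∷ α) α′ * δ (y ∷ β) β′)
    ≡⟨ ∑-cartesian _ _ (upTo (suc a)) (splits e) ⟩
  ∑ (upTo (suc a)) (λ i → ∑ (splits e) (λ (α′ , β′) → δ (x ∷ α) (i ∷ α′) * δ (y ∷ β) ((a ∸ i) ∷ β′)))
    ≡⟨ ∑-cong (upTo (suc a)) (λ i → trans (∑-cong (splits e) (λ (α′ , β′) → separate i α′ β′))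
                                          (∑-*ˡ (⟦ does (x ℕ.≟ i) ⟧ * ⟦ does (y ℕ.≟ (a ∸ i)) ⟧) _ (splits e))) ⟩
  ∑ (upTo (suc a)) (λ i → ⟦ does (x ℕ.≟ i) ⟧ * ⟦ does (y ℕ.≟ (a ∸ i)) ⟧ * ∑ (splits e) (λ (α′ , β′) → δ α α′ * δ β β′))
    ≡⟨ ∑-*ʳ (∑ (splits e) (λ (α′ , β′) → δ α α′ * δ β β′)) (λ i → ⟦ does (x ℕ.≟ i) ⟧ * ⟦ does (y ℕ.≟ (a ∸ i)) ⟧) (upTo (suc a)) ⟩
  ∑ (upTo (suc a)) (λ i → ⟦ does (x ℕ.≟ i) ⟧ * ⟦ does (y ℕ.≟ (a ∸ i)) ⟧) * ∑ (splits e) (λ (α′ , β′) → δ α α′ * δ β β′)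
    ≡⟨ cong₂ _*_ (∑-antidiagonal x y a) (∑-splits-δ α β e) ⟩
  ⟦ does ((x ℕ.+ y) ℕ.≟ a) ⟧ * δ (α ⊞ β) e
    ≡⟨ ⟦∧⟧ (does ((x ℕ.+ y) ℕ.≟ a)) (does ((α ⊞ β) ≟ᵉ e)) ⟨
  δ ((x ∷ α) ⊞ (y ∷ β)) (a ∷ e) ∎
  where
  separate : ∀ i α′ β′ → δ (x ∷ α) (i ∷ α′) * δ (y ∷ β) ((a ∸ i) ∷ β′) ≡
             ⟦ does (x ℕ.≟ i) ⟧ * ⟦ does (y ℕ.≟ (a ∸ i)) ⟧ * (δ α α′ * δ β β′)
  separate i α′ β′ = trans (cong₂ _*_ (⟦∧⟧ (does (x ℕ.≟ i)) _) (⟦∧⟧ (does (y ℕ.≟ (a ∸ i))) _))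
    (solve 4 (λ a b c d → (a :* b) :* (c :* d) := (a :* c) :* (b :* d)) refl
       ⟦ does (x ℕ.≟ i) ⟧ (δ α α′) ⟦ does (y ℕ.≟ (a ∸ i)) ⟧ (δ β β′))

-- A polynomial in m variables as an unreduced list of terms: exponents may repeat, so lists
-- multiply without collecting like terms.
Terms : ℕ → Set
Terms m = List (ℚ × Exponent m)

coefficient : Terms m → Exponent m → ℚ
coefficient L e = ∑ L (λ (c , α) → c * δ α e)

_⊠_ : Terms m → Terms m → Terms m
_⊠_ = cartesianProductWith (λ (c , α) (d , β) → c * d , α ⊞ β)

coefficient-⊠ : ∀ (L K : Terms m) e →
  ∑ (splits e) (λ (α , β) → coefficient L α * coefficient K β) ≡ coefficient (L ⊠ K) e
coefficient-⊠ L K e = begin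
  ∑ (splits e) (λ (α′ , β′) → coefficient L α′ * coefficient K β′)
    ≡⟨ ∑-cong (splits e) (λ (α′ , β′) → sym (∑-*ʳ _ _ L)) ⟩
  ∑ (splits e) (λ (α′ , β′) → ∑ L (λ (c , α) → c * δ α α′ * coefficient K β′))
    ≡⟨ ∑-swap _ (splits e) L ⟩
  ∑ L (λ (c , α) → ∑ (splits e) (λ (α′ , β′) → c * δ α α′ * coefficient K β′))
    ≡⟨ ∑-cong L (λ (c , α) → trans (∑-cong (splits e) (λ (α′ , β′) → sym (∑-*ˡ (c * δ α α′) _ K)))
                                   (∑-swap _ (splits e) K)) ⟩
  ∑ L (λ (c , α) → ∑ K (λ (d , β) → ∑ (splits e) (λ (α′ , β′) → c * δ α α′ * (d * δ β β′))))
    ≡⟨ ∑-cong L (λ (c , α) → ∑-cong K (λ (d , β) →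
         trans (∑-cong (splits e) (λ (α′ , β′) →
                  solve 4 (λ a b c d → (a :* b) :* (c :* d) := (a :* c) :* (b :* d)) refl c (δ α α′) d (δ β β′)))
         (trans (∑-*ˡ (c * d) _ (splits e)) (cong (c * d *_) (∑-splits-δ α β e))))) ⟩
  ∑ L (λ (c , α) → ∑ K (λ (d , β) → c * d * δ (α ⊞ β) e))
    ≡⟨ ∑-cartesian _ _ L K ⟨
  coefficient (L ⊠ K) e ∎

∏^ : Vec ℚ m → Exponent m → ℚ
∏^ []      []      = 1ℚ
∏^ (x ∷ y) (a ∷ α) = x ^ a * ∏^ y α

∏^-⊞ : ∀ (y : Vec ℚ m) α β → ∏^ y (α ⊞ β) ≡ ∏^ y α * ∏^ y β
∏^-⊞ []      []      []      = refl
∏^-⊞ (x ∷ y) (a ∷ α) (b ∷ β) = trans (cong₂ _*_ (^-homo-* x a b) (∏^-⊞ y α β))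
  (solve 4 (λ a b c d → (a :* b) :* (c :* d) := (a :* c) :* (b :* d)) refl (x ^ a) (x ^ b) (∏^ y α) (∏^ y β))

module _ (y : Vec ℚ m) where

  evaluate : Terms m → ℚ
  evaluate L = ∑ L (λ (c , α) → c * ∏^ y α)

  evaluate-⊠ : ∀ L K → evaluate (L ⊠ K) ≡ evaluate L * evaluate K
  evaluate-⊠ L K = begin
    evaluate (L ⊠ K)
      ≡⟨ ∑-cartesian _ _ L K ⟩
    ∑ L (λ (c , α) → ∑ K (λ (d , β) → c * d * ∏^ y (α ⊞ β)))
      ≡⟨ ∑-cong L (λ (c , α) → trans (∑-cong K (λ (d , β) →
           trans (cong (c * d *_) (∏^-⊞ y α β))
                 (solve 4 (λ a b c d → (a :* c) :* (b :* d) := (a :* b) :* (c :* d)) refl c (∏^ y α) d (∏^ y β))))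
           (∑-*ˡ (c * ∏^ y α) _ K)) ⟩
    ∑ L (λ (c , α) → c * ∏^ y α * evaluate K)
      ≡⟨ ∑-*ʳ _ _ L ⟩
    evaluate L * evaluate K ∎

  evaluate-coefficient : ∀ L {B} → Unique B → (∀ {t} → t ∈ˡ L → proj₂ t ∈ˡ B) →
                         evaluate L ≡ ∑ B (λ e → coefficient L e * ∏^ y e)
  evaluate-coefficient L {B} u L⊆B = sym (begin
    ∑ B (λ e → coefficient L e * ∏^ y e)
      ≡⟨ ∑-cong B (λ e → sym (∑-*ʳ _ _ L)) ⟩
    ∑ B (λ e → ∑ L (λ (c , α) → c * δ α e * ∏^ y e))
      ≡⟨ ∑-swap _ B L ⟩
    ∑ L (λ (c , α) → ∑ B (λ e → c * δ α e * ∏^ y e))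
      ≡⟨ ∑-cong-∈ L (λ (c , α) t∈ →
           trans (trans (∑-cong B (λ e → *-assoc c (δ α e) (∏^ y e))) (∑-*ˡ c _ B))
                 (cong (c *_) (∑-pick _≟ᵉ_ α (∏^ y) u (L⊆B t∈)))) ⟩
    evaluate L ∎)

  -- Different lists can carry the same coefficients. Both are collected over one duplicate-free
  -- list of all their exponents, where only the coefficients enter.
  evaluate-unique : ∀ L K → (∀ e → coefficient L e ≡ coefficient K e) → evaluate L ≡ evaluate K
  evaluate-unique L K eq = begin
    evaluate L                           ≡⟨ evaluate-coefficient L u (λ t∈ → inB (∈ˡ.∈-++⁺ˡ (∈ˡ.∈-map⁺ proj₂ t∈))) ⟩
    ∑ box (λ e → coefficient L e * ∏^ y e) ≡⟨ ∑-cong box (λ e → cong (_* _) (eq e)) ⟩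
    ∑ box (λ e → coefficient K e * ∏^ y e) ≡⟨ evaluate-coefficient K u (λ t∈ → inB (∈ˡ.∈-++⁺ʳ _ (∈ˡ.∈-map⁺ proj₂ t∈))) ⟨
    evaluate K                           ∎
    where
    box = deduplicate _≟ᵉ_ (map proj₂ L ++ map proj₂ K)
    u = UniqueDec.deduplicate-! _≟ᵉ_ (map proj₂ L ++ map proj₂ K)
    inB : ∀ {e} → e ∈ˡ map proj₂ L ++ map proj₂ K → e ∈ˡ box
    inB = ∈ˡ.∈-deduplicate⁺ _≟ᵉ_

-- Values of series at a point

unit : Fin m → ℕ → Exponent m
unit {m} c a = replicate m 0 [ c ]≔ a

δ-sym : ∀ (α e : Exponent m) → δ α e ≡ δ e α
δ-sym α e = cong ⟦_⟧ (does-⇔ (mk⇔ sym sym) (α ≟ᵉ e) (e ≟ᵉ α))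

∏^-0 : ∀ (y : Vec ℚ m) → ∏^ y (replicate m 0) ≡ 1ℚ
∏^-0 []      = refl
∏^-0 (x ∷ y) = trans (*-identityˡ _) (∏^-0 y)

∏^-unit : ∀ (y : Vec ℚ m) c a → ∏^ y (unit c a) ≡ lookup y c ^ a
∏^-unit (x ∷ y) Fin.zero    a = trans (cong (x ^ a *_) (∏^-0 y)) (*-identityʳ _)
∏^-unit (x ∷ y) (Fin.suc c) a = trans (*-identityˡ _) (∏^-unit y c a)

-- A family of coefficients can be evaluated at y once its part in the first m variables is finite,
-- which `terms` witnesses; the remaining variables are thereby set to 0.
record HasValue (f : Series) (y : Vec ℚ m) (r : ℚ) : Set where
  constructor hasValue
  field
    terms        : Terms m
    coefficients : ∀ e → f m e ≡ coefficient terms e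
    evaluation   : evaluate y terms ≡ r

module _ {y : Vec ℚ m} where

  value-unique : ∀ {f g r s} → f ≈ g → HasValue f y r → HasValue g y s → r ≡ s
  value-unique f≈g (hasValue L f≡ refl) (hasValue K g≡ refl) =
    evaluate-unique y L K (λ e → trans (sym (f≡ e)) (trans (f≈g m e) (g≡ e)))

  value-𝟘 : HasValue 𝟘 y 0ℚ
  value-𝟘 = hasValue [] (λ _ → refl) refl

  value-𝟙 : HasValue 𝟙 y 1ℚ
  value-𝟙 = hasValue [ 1ℚ , replicate m 0 ]
    (λ e → sym (trans (+-identityʳ _) (trans (*-identityˡ _) (δ-sym (replicate m 0) e))))
    (trans (+-identityʳ _) (trans (*-identityˡ _) (∏^-0 y)))

  value-⊕ : ∀ {f g r s} → HasValue f y r → HasValue g y s → HasValue (f ⊕ g) y (r + s)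
  value-⊕ (hasValue L f≡ refl) (hasValue K g≡ refl) = hasValue (L ++ K)
    (λ e → trans (cong₂ _+_ (f≡ e) (g≡ e)) (sym (∑-++ _ L K))) (∑-++ _ L K)

  value-· : ∀ c {f r} → HasValue f y r → HasValue (c · f) y (c * r)
  value-· c (hasValue L f≡ refl) = hasValue (map (λ (d , α) → c * d , α) L)
    (λ e → trans (cong (c *_) (f≡ e)) (sym (scale (λ α → δ α e)))) (scale (∏^ y))
    where
    scale : ∀ (h : Exponent m → ℚ) → ∑ (map (λ (d , α) → c * d , α) L) (λ (d , α) → d * h α) ≡
            c * ∑ L (λ (d , α) → d * h α)
    scale h = trans (∑-map _ _ L)
      (trans (∑-cong L (λ (d , α) → *-assoc c d (h α))) (∑-*ˡ c _ L))

  value-⊗ : ∀ {f g r s} → HasValue f y r → HasValue g y s → HasValue (f ⊗ g) y (r * s)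
  value-⊗ (hasValue L f≡ refl) (hasValue K g≡ refl) = hasValue (L ⊠ K)
    (λ e → trans (∑-cong (splits e) (λ (α , β) → cong₂ _*_ (f≡ α) (g≡ β))) (coefficient-⊠ L K e))
    (evaluate-⊠ y L K)

  value-∑ : ∀ (F : A → Series) r xs → (∀ x → HasValue (F x) y (r x)) →
            HasValue (foldr _⊕_ 𝟘 (map F xs)) y (∑ xs r)
  value-∑ F r []       v = value-𝟘
  value-∑ F r (x ∷ xs) v = value-⊕ (v x) (value-∑ F r xs v)

-- Values of the power sums and of ζₙ

pTerms : ∀ m → ℕ → Terms m
pTerms m a = map (λ i → 1ℚ , unit i a) (allFin m)

p-coefficient : ∀ a (e : Exponent m) → p a m e ≡ coefficient (pTerms m a) e
p-coefficient {m} a e = begin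
  p a m e
    ≡⟨ length-filter (λ i → e ≟ᵉ unit i a) (allFin m) ⟩
  ∑ (allFin m) (λ i → δ e (unit i a))
    ≡⟨ ∑-cong (allFin m) (λ i → trans (δ-sym e (unit i a)) (sym (*-identityˡ _))) ⟩
  ∑ (allFin m) (λ i → 1ℚ * δ (unit i a) e)
    ≡⟨ ∑-map _ _ (allFin m) ⟨
  coefficient (pTerms m a) e ∎

value-p : ∀ (y : Vec ℚ m) a → HasValue (p a) y (∑ (allFin m) (λ i → lookup y i ^ a))
value-p {m} y a = hasValue (pTerms m a) (p-coefficient a)
  (trans (∑-map _ _ (allFin m)) (∑-cong (allFin m) (λ i → trans (*-identityˡ _) (∏^-unit y i a))))

∑-upTo-first : ∀ n (f : ℕ → ℚ) → ∑ (upTo (suc n)) f ≡ f 0 + ∑ (upTo n) (f ∘ suc)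
∑-upTo-first n f = cong (f 0 +_)
  (trans (cong (λ xs → ∑ xs f) (sym (List.map-upTo suc n))) (∑-map f suc (upTo n)))

∑-upTo-last : ∀ n (f : ℕ → ℚ) → ∑ (upTo (suc n)) f ≡ ∑ (upTo n) f + f n
∑-upTo-last n f = trans (cong (λ xs → ∑ xs f) (sym (List.upTo-∷ʳ n)))
  (trans (∑-++ f (upTo n) [ n ]) (cong (∑ (upTo n) f +_) (+-identityʳ (f n))))

∑-allFin : ∀ n (f : Fin (suc n) → ℚ) → ∑ (allFin (suc n)) f ≡ f Fin.zero + ∑ (allFin n) (f ∘ Fin.suc)
∑-allFin n f = cong (f Fin.zero +_)
  (trans (cong (λ xs → ∑ xs f) (sym (List.map-tabulate id Fin.suc))) (∑-map f Fin.suc (allFin n)))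

-- The binomial theorem with its constant term set apart, because ζₙ starts at p₁. Pascal's rule
-- splits the sum into x times the full row n and the same row without its constant term.
binomial : ∀ n x → 1ℚ + ∑ (upTo n) (λ a → fromℕ (n C suc a) * x ^ suc a) ≡ (1ℚ + x) ^ n
binomial zero    x = refl
binomial (suc n) x = begin
  1ℚ + ∑ (upTo (suc n)) (λ a → fromℕ (suc n C suc a) * x ^ suc a)
    ≡⟨ cong (1ℚ +_) (∑-cong (upTo (suc n)) pascal) ⟩
  1ℚ + ∑ (upTo (suc n)) (λ a → x * (fromℕ (n C a) * x ^ a) + fromℕ (n C suc a) * x ^ suc a)
    ≡⟨ cong (1ℚ +_) (∑-+ (λ a → x * (fromℕ (n C a) * x ^ a)) _ (upTo (suc n))) ⟩
  1ℚ + (∑ (upTo (suc n)) (λ a → x * (fromℕ (n C a) * x ^ a)) + ∑ (upTo (suc n)) (λ a → fromℕ (n C suc a) * x ^ suc a))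
    ≡⟨ cong (1ℚ +_) (cong₂ _+_ (trans (∑-*ˡ x (λ a → fromℕ (n C a) * x ^ a) (upTo (suc n))) (cong (x *_) first)) last) ⟩
  1ℚ + (x * (1ℚ + S) + S)
    ≡⟨ solve 2 (λ x s → con 1ℚ :+ (x :* (con 1ℚ :+ s) :+ s) := (con 1ℚ :+ x) :* (con 1ℚ :+ s)) refl x S ⟩
  (1ℚ + x) * (1ℚ + S)
    ≡⟨ cong ((1ℚ + x) *_) (binomial n x) ⟩
  (1ℚ + x) ^ suc n ∎
  where
  S = ∑ (upTo n) (λ a → fromℕ (n C suc a) * x ^ suc a)
  pascal : ∀ a → fromℕ (suc n C suc a) * x ^ suc a ≡
           x * (fromℕ (n C a) * x ^ a) + fromℕ (n C suc a) * x ^ suc a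
  pascal a = trans
    (cong (_* x ^ suc a) (trans (cong fromℕ (sym (nCk+nC[k+1]≡[n+1]C[k+1] n a))) (fromℕ-+ (n C a) (n C suc a))))
    (solve 4 (λ x q a b → (a :+ b) :* (x :* q) := x :* (a :* q) :+ b :* (x :* q)) refl
       x (x ^ a) (fromℕ (n C a)) (fromℕ (n C suc a)))
  first : ∑ (upTo (suc n)) (λ a → fromℕ (n C a) * x ^ a) ≡ 1ℚ + S
  first = trans (∑-upTo-first n (λ a → fromℕ (n C a) * x ^ a))
    (cong (_+ S) (*-identityˡ 1ℚ))
  last : ∑ (upTo (suc n)) (λ a → fromℕ (n C suc a) * x ^ suc a) ≡ S
  last = trans (∑-upTo-last n (λ a → fromℕ (n C suc a) * x ^ suc a))
    (trans (cong (λ c → S + fromℕ c * x ^ suc n) (k>n⇒nCk≡0 (ℕ.n<1+n n)))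
           (trans (cong (S +_) (*-zeroˡ (x ^ suc n))) (+-identityʳ S)))

-- After exchanging the sums, each variable contributes its own binomial expansion without the
-- constant term.
value-ζ : ∀ (y : Vec ℚ m) n → HasValue (ζ n) y (∑ (allFin m) (λ i → (1ℚ + lookup y i) ^ n - 1ℚ))
value-ζ {m} y n = subst (HasValue (ζ n) y) eq
  (value-∑ _ _ (upTo n) (λ a → value-· (fromℕ (n C suc a)) {p (suc a)} (value-p y (suc a))))
  where
  eq : ∑ (upTo n) (λ a → fromℕ (n C suc a) * ∑ (allFin m) (λ i → lookup y i ^ suc a)) ≡
       ∑ (allFin m) (λ i → (1ℚ + lookup y i) ^ n - 1ℚ)
  eq = begin
    ∑ (upTo n) (λ a → fromℕ (n C suc a) * ∑ (allFin m) (λ i → lookup y i ^ suc a))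
      ≡⟨ ∑-cong (upTo n) (λ a → sym (∑-*ˡ (fromℕ (n C suc a)) (λ i → lookup y i ^ suc a) (allFin m))) ⟩
    ∑ (upTo n) (λ a → ∑ (allFin m) (λ i → fromℕ (n C suc a) * lookup y i ^ suc a))
      ≡⟨ ∑-swap _ (upTo n) (allFin m) ⟩
    ∑ (allFin m) (λ i → ∑ (upTo n) (λ a → fromℕ (n C suc a) * lookup y i ^ suc a))
      ≡⟨ ∑-cong (allFin m) (λ i → trans
           (solve 1 (λ s → s := (con 1ℚ :+ s) :- con 1ℚ) refl _)
           (cong (_- 1ℚ) (binomial n (lookup y i)))) ⟩
    ∑ (allFin m) (λ i → (1ℚ + lookup y i) ^ n - 1ℚ) ∎

∑-const : ∀ c (xs : List A) → ∑ xs (λ _ → c) ≡ fromℕ (length xs) * c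
∑-const c []       = sym (*-zeroˡ c)
∑-const c (x ∷ xs) = trans (cong (c +_) (∑-const c xs))
  (trans (solve 2 (λ c l → c :+ l :* c := (con 1ℚ :+ l) :* c) refl c (fromℕ (length xs)))
         (cong (_* c) (sym (fromℕ-+ 1 (length xs)))))

-- At x, -1, …, -1 the series ζ₁, ζ₂, … take values linear in the number of -1's.
special : ℚ → ∀ m → Vec ℚ (suc m)
special x m = x ∷ replicate m (- 1ℚ)

-- Each entry -1 contributes 0ⁿ - 1 = -1, where n ≥ 1 makes the power vanish; with the -1 coming
-- from the entry x this totals -(m + 1).
value-ζ-special : ∀ x m n .{{_ : ℕ.NonZero n}} →
                  HasValue (ζ n) (special x m) ((1ℚ + x) ^ n - fromℕ (suc m))
value-ζ-special x m n@(suc k) = subst (HasValue (ζ n) (special x m)) eq (value-ζ (special x m) n)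
  where
  eq : ∑ (allFin (suc m)) (λ i → (1ℚ + lookup (special x m) i) ^ n - 1ℚ) ≡ (1ℚ + x) ^ n - fromℕ (suc m)
  eq = begin
    ∑ (allFin (suc m)) (λ i → (1ℚ + lookup (special x m) i) ^ n - 1ℚ)
      ≡⟨ ∑-allFin m (λ i → (1ℚ + lookup (special x m) i) ^ n - 1ℚ) ⟩
    (1ℚ + x) ^ n - 1ℚ + ∑ (allFin m) (λ i → (1ℚ + lookup (replicate m (- 1ℚ)) i) ^ n - 1ℚ)
      ≡⟨ cong ((1ℚ + x) ^ n - 1ℚ +_) (trans (∑-cong (allFin m) (λ i →
           trans (cong (λ z → (1ℚ + z) ^ n - 1ℚ) (Vec.lookup-replicate i (- 1ℚ)))
                 (cong (_- 1ℚ) (*-zeroˡ (0ℚ ^ k)))))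
           (∑-const (0ℚ - 1ℚ) (allFin m))) ⟩
    (1ℚ + x) ^ n - 1ℚ + fromℕ (length (allFin m)) * (0ℚ - 1ℚ)
      ≡⟨ cong (λ l → (1ℚ + x) ^ n - 1ℚ + fromℕ l * (0ℚ - 1ℚ)) (List.length-tabulate {n = m} id) ⟩
    (1ℚ + x) ^ n - 1ℚ + fromℕ m * (0ℚ - 1ℚ)
      ≡⟨ solve 2 (λ t l → t :- con 1ℚ :+ l :* (con 0ℚ :- con 1ℚ) := t :- (con 1ℚ :+ l)) refl ((1ℚ + x) ^ n) (fromℕ m) ⟩
    (1ℚ + x) ^ n - (1ℚ + fromℕ m)
      ≡⟨ cong (λ l → (1ℚ + x) ^ n - l) (fromℕ-+ 1 m) ⟨
    (1ℚ + x) ^ n - fromℕ (suc m) ∎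

-- t stands for 1 + x and s for the number m + 1 of variables. As s is a free parameter, s = 0 makes
-- sense although no point has m + 1 = 0 entries.
monomialAt : ℚ → ℚ → Monomial → ℚ
monomialAt t s μ = foldr (λ n r → (t ^ value n - s) * r) 1ℚ μ

polynomialAt : ℚ → ℚ → Polynomial → ℚ
polynomialAt t s P = ∑ P (λ (c , μ) → c * monomialAt t s μ)

value-evalMonomial : ∀ x m μ → HasValue (evalMonomial μ) (special x m) (monomialAt (1ℚ + x) (fromℕ (suc m)) μ)
value-evalMonomial x m []      = value-𝟙
value-evalMonomial x m (mkIndex n ∷ μ) =
  value-⊗ {f = ζ n} {evalMonomial μ} (value-ζ-special x m n) (value-evalMonomial x m μ)

value-eval : ∀ x m P → HasValue (eval P) (special x m) (polynomialAt (1ℚ + x) (fromℕ (suc m)) P)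
value-eval x m P = value-∑ _ _ P (λ (c , μ) → value-· c {evalMonomial μ} (value-evalMonomial x m μ))

-- Sequences given by a polynomial

Δ : (ℕ → ℚ) → (ℕ → ℚ)
Δ f k = f (suc k) - f k

-- Over ℚ the vanishing of the d-th difference characterises polynomials of degree less than d
-- without naming coefficients.
Degree< : ℕ → (ℕ → ℚ) → Set
Degree< zero    f = ∀ k → f k ≡ 0ℚ
Degree< (suc d) f = Degree< d (Δ f)

degree-cong : ∀ d {f g} → (∀ k → f k ≡ g k) → Degree< d f → Degree< d g
degree-cong zero    eq f0 k = trans (sym (eq k)) (f0 k)
degree-cong (suc d) eq      = degree-cong d (λ k → cong₂ _-_ (eq (suc k)) (eq k))

degree-suc : ∀ d {f} → Degree< d f → Degree< (suc d) f
degree-suc zero    f0 k = cong₂ _-_ (f0 (suc k)) (f0 k)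
degree-suc (suc d)      = degree-suc d

degree-weaken : ∀ c d {f} → Degree< d f → Degree< (c ℕ.+ d) f
degree-weaken zero    d f< = f<
degree-weaken (suc c) d f< = degree-suc (c ℕ.+ d) (degree-weaken c d f<)

degree-+ : ∀ d {f g} → Degree< d f → Degree< d g → Degree< d (λ k → f k + g k)
degree-+ zero            f0 g0 k = cong₂ _+_ (f0 k) (g0 k)
degree-+ (suc d) {f} {g} f< g<   = degree-cong d
  (λ k → solve 4 (λ a b c d → (a :- b) :+ (c :- d) := (a :+ c) :- (b :+ d)) refl (f (suc k)) (f k) (g (suc k)) (g k))
  (degree-+ d f< g<)

degree-*ˡ : ∀ d c {f} → Degree< d f → Degree< d (λ k → c * f k)
degree-*ˡ zero    c     f0 k = trans (cong (c *_) (f0 k)) (*-zeroʳ c)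
degree-*ˡ (suc d) c {f} f<   = degree-cong d
  (λ k → solve 3 (λ c a b → c :* (a :- b) := c :* a :- c :* b) refl c (f (suc k)) (f k))
  (degree-*ˡ d c f<)

degree-shift : ∀ d {f} → Degree< d f → Degree< d (f ∘ suc)
degree-shift zero    f0 k = f0 (suc k)
degree-shift (suc d) f<   = degree-shift d f<

-- From Δ(k f(k)) = k Δf(k) + f(k + 1), by induction on d.
degree-id* : ∀ d {f} → Degree< d f → Degree< (suc d) (λ k → fromℕ k * f k)
degree-id* zero    {f} f0 k = cong₂ _-_
  (trans (cong (fromℕ (suc k) *_) (f0 (suc k))) (*-zeroʳ (fromℕ (suc k))))
  (trans (cong (fromℕ k *_) (f0 k)) (*-zeroʳ (fromℕ k)))
degree-id* (suc d) {f} f<   = degree-cong (suc d)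
  (λ k → trans
    (solve 3 (λ n a b → n :* (a :- b) :+ a := (con 1ℚ :+ n) :* a :- n :* b) refl (fromℕ k) (f (suc k)) (f k))
    (cong (λ n → n * f (suc k) - fromℕ k * f k) (sym (fromℕ-+ 1 k))))
  (degree-+ (suc d) {λ k → fromℕ k * Δ f k} {f ∘ suc} (degree-id* d f<) (degree-shift (suc d) {f} f<))

record IsPolynomial (f : ℕ → ℚ) : Set where
  constructor isPolynomial
  field
    bound  : ℕ
    degree : Degree< bound f

poly-cong : ∀ {f g} → (∀ k → f k ≡ g k) → IsPolynomial f → IsPolynomial g
poly-cong eq (isPolynomial d f<) = isPolynomial d (degree-cong d eq f<)

poly-0 : IsPolynomial (λ _ → 0ℚ)
poly-0 = isPolynomial 0 (λ _ → refl)

poly-const : ∀ c → IsPolynomial (λ _ → c)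
poly-const c = isPolynomial 1 (λ _ → +-inverseʳ c)

poly-Δ : ∀ f → IsPolynomial (Δ f) → IsPolynomial f
poly-Δ f (isPolynomial d f<) = isPolynomial (suc d) f<

poly-+ : ∀ {f g} → IsPolynomial f → IsPolynomial g → IsPolynomial (λ k → f k + g k)
poly-+ {f} {g} (isPolynomial c f<) (isPolynomial d g<) = isPolynomial (c ℕ.+ d)
  (degree-+ (c ℕ.+ d) (subst (λ b → Degree< b f) (ℕ.+-comm d c) (degree-weaken d c f<)) (degree-weaken c d g<))

poly-*ˡ : ∀ c {f} → IsPolynomial f → IsPolynomial (λ k → c * f k)
poly-*ˡ c (isPolynomial d f<) = isPolynomial d (degree-*ˡ d c f<)

poly-id* : ∀ {f} → IsPolynomial f → IsPolynomial (λ k → fromℕ k * f k)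
poly-id* (isPolynomial d f<) = isPolynomial (suc d) (degree-id* d f<)

poly-∑ : ∀ (f : A → ℕ → ℚ) xs → (∀ x → x ∈ˡ xs → IsPolynomial (f x)) → IsPolynomial (λ k → ∑ xs (λ x → f x k))
poly-∑ f []       poly = poly-0
poly-∑ f (x ∷ xs) poly = poly-+ (poly x (here refl)) (poly-∑ f xs (λ y y∈ → poly y (there y∈)))

poly-^ : ∀ n → IsPolynomial (λ k → fromℕ k ^ n)
poly-^ zero    = poly-const 1ℚ
poly-^ (suc n) = poly-id* (poly-^ n)

-- By induction on the degree: Δf also vanishes at positive arguments, hence at 0, and f(0) = f(1) -
-- Δf(0).
vanishes-at-0 : ∀ {f} → IsPolynomial f → (∀ k → f (suc k) ≡ 0ℚ) → f 0 ≡ 0ℚ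
vanishes-at-0 (isPolynomial d f<) = go d f<
  where
  go : ∀ d {f} → Degree< d f → (∀ k → f (suc k) ≡ 0ℚ) → f 0 ≡ 0ℚ
  go zero        f0 _  = f0 0
  go (suc d) {f} f< f₊ = begin
    f 0          ≡⟨ solve 2 (λ a b → a := b :- (b :- a)) refl (f 0) (f 1) ⟩
    f 1 - Δ f 0  ≡⟨ cong₂ _-_ (f₊ 0) (go d f< (λ k → cong₂ _-_ (f₊ (suc k)) (f₊ k))) ⟩
    0ℚ           ∎

-- Serves twice: for setting m = -1, the index being m + 1, and for filling in the point t = 0 after
-- a division by t.
agree-at-0 : ∀ {f g} → IsPolynomial f → IsPolynomial g → (∀ k → f (suc k) ≡ g (suc k)) → f 0 ≡ g 0
agree-at-0 {f} {g} pf pg eq = begin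
  f 0                              ≡⟨ solve 2 (λ a b → a := (a :+ con (- 1ℚ) :* b) :+ b) refl (f 0) (g 0) ⟩
  f 0 + - 1ℚ * g 0 + g 0           ≡⟨ cong (_+ g 0) (vanishes-at-0 (poly-+ pf (poly-*ˡ (- 1ℚ) pg))
                                         (λ k → trans (cong (_+ - 1ℚ * g (suc k)) (eq k))
                                            (solve 1 (λ b → b :+ con (- 1ℚ) :* b := con 0ℚ) refl (g (suc k))))) ⟩
  0ℚ + g 0                         ≡⟨ +-identityˡ (g 0) ⟩
  g 0                              ∎

poly-polynomialAt : ∀ t P → IsPolynomial (λ k → polynomialAt t (fromℕ k) P)
poly-polynomialAt t P = poly-∑ _ P (λ (c , μ) _ → poly-*ˡ c (monomial μ))
  where
  monomial : ∀ μ → IsPolynomial (λ k → monomialAt t (fromℕ k) μ)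
  monomial []      = poly-const 1ℚ
  monomial (n ∷ μ) = poly-cong
    (λ k → solve 3 (λ a s r → a :* r :+ con (- 1ℚ) :* (s :* r) := (a :- s) :* r) refl
             (t ^ value n) (fromℕ k) (monomialAt t (fromℕ k) μ))
    (poly-+ (poly-*ˡ (t ^ value n) (monomial μ)) (poly-*ˡ (- 1ℚ) (poly-id* (monomial μ))))

-- At s = 0 the factors are pure powers of t, whose exponents add up: this is where the index sum
-- enters.
polynomialAt-0 : ∀ t P → polynomialAt t 0ℚ P ≡ ∑ P (λ (c , μ) → c * t ^ indexSum μ)
polynomialAt-0 t P = ∑-cong P (λ (c , μ) → cong (c *_) (monomial μ))
  where
  monomial : ∀ μ → monomialAt t 0ℚ μ ≡ t ^ indexSum μ
  monomial []      = refl
  monomial (n ∷ μ) = trans (cong₂ _*_ (+-identityʳ (t ^ value n)) (monomial μ))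
                           (sym (^-homo-* t (value n) (indexSum μ)))

-- Recovering coefficients from values

powerSum : List (ℚ × ℕ) → ℚ → ℚ
powerSum L t = ∑ L (λ (c , n) → c * t ^ n)

coefficientAt : ℕ → List (ℚ × ℕ) → ℚ
coefficientAt k L = ∑ L (λ (c , n) → c * ⟦ does (n ℕ.≟ k) ⟧)

-- (f(t) − f(0)) / t, where f is powerSum L
lower : List (ℚ × ℕ) → List (ℚ × ℕ)
lower []                = []
lower ((c , zero) ∷ L)  = lower L
lower ((c , suc n) ∷ L) = (c , n) ∷ lower L

powerSum-lower : ∀ L t → powerSum L t ≡ coefficientAt 0 L + t * powerSum (lower L) t
powerSum-lower []                t = sym (trans (+-identityˡ _) (*-zeroʳ t))
powerSum-lower ((c , zero) ∷ L)  t = trans (cong (c * 1ℚ +_) (powerSum-lower L t)) (sym (+-assoc (c * 1ℚ) _ _))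
powerSum-lower ((c , suc n) ∷ L) t = trans (cong (c * (t * t ^ n) +_) (powerSum-lower L t))
  (solve 5 (λ c t q a s → c :* (t :* q) :+ (a :+ t :* s) := (c :* con 0ℚ :+ a) :+ t :* (c :* q :+ s)) refl
     c t (t ^ n) (coefficientAt 0 L) (powerSum (lower L) t))

coefficientAt-lower : ∀ k L → coefficientAt k (lower L) ≡ coefficientAt (suc k) L
coefficientAt-lower k []                = refl
coefficientAt-lower k ((c , zero) ∷ L)  = trans (coefficientAt-lower k L)
  (sym (trans (cong (_+ coefficientAt (suc k) L) (*-zeroʳ c)) (+-identityˡ _)))
coefficientAt-lower k ((c , suc n) ∷ L) = cong (c * ⟦ does (n ℕ.≟ k) ⟧ +_) (coefficientAt-lower k L)

cancel-suc : ∀ n {a b} → fromℕ (suc n) * a ≡ fromℕ (suc n) * b → a ≡ b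
cancel-suc n eq = ≤-antisym (*-cancelˡ-≤-pos (fromℕ (suc n)) (≤-reflexive eq))
                            (*-cancelˡ-≤-pos (fromℕ (suc n)) (≤-reflexive (sym eq)))
  where instance positive = normalize-pos (suc n) 1

-- The values at 0 give the constant terms; removing them and dividing by t leaves the case of k -
-- 1.
coefficients-equal : ∀ L K → (∀ n → powerSum L (fromℕ n) ≡ powerSum K (fromℕ n)) →
                     ∀ k → coefficientAt k L ≡ coefficientAt k K
coefficients-equal L K eq zero = begin
  coefficientAt 0 L ≡⟨ at-0 L ⟨
  powerSum L 0ℚ     ≡⟨ eq 0 ⟩
  powerSum K 0ℚ     ≡⟨ at-0 K ⟩
  coefficientAt 0 K ∎
  where
  at-0 : ∀ L → powerSum L 0ℚ ≡ coefficientAt 0 L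
  at-0 L = trans (powerSum-lower L 0ℚ)
    (trans (cong (coefficientAt 0 L +_) (*-zeroˡ (powerSum (lower L) 0ℚ))) (+-identityʳ _))
coefficients-equal L K eq (suc k) = begin
  coefficientAt (suc k) L   ≡⟨ coefficientAt-lower k L ⟨
  coefficientAt k (lower L) ≡⟨ coefficients-equal (lower L) (lower K) lower-eq k ⟩
  coefficientAt k (lower K) ≡⟨ coefficientAt-lower k K ⟩
  coefficientAt (suc k) K   ∎
  where
  poly : ∀ L → IsPolynomial (λ n → powerSum L (fromℕ n))
  poly L = poly-∑ _ L (λ (c , n) _ → poly-*ˡ c (poly-^ n))
  lower-eq₊ : ∀ n → powerSum (lower L) (fromℕ (suc n)) ≡ powerSum (lower K) (fromℕ (suc n))
  lower-eq₊ n = cancel-suc n (+-cancelˡ (coefficientAt 0 L) (t * powerSum (lower L) t) (t * powerSum (lower K) t) (begin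
    coefficientAt 0 L + t * powerSum (lower L) t ≡⟨ powerSum-lower L t ⟨
    powerSum L t                                 ≡⟨ eq (suc n) ⟩
    powerSum K t                                 ≡⟨ powerSum-lower K t ⟩
    coefficientAt 0 K + t * powerSum (lower K) t ≡⟨ cong (_+ t * powerSum (lower K) t) (coefficients-equal L K eq 0) ⟨
    coefficientAt 0 L + t * powerSum (lower K) t ∎))
    where
    t = fromℕ (suc n)
  lower-eq : ∀ n → powerSum (lower L) (fromℕ n) ≡ powerSum (lower K) (fromℕ n)
  -- The division by t gives no information at t = 0; there both quotients are extrapolated from the
  -- positive integers.
  lower-eq zero    = agree-at-0 (poly (lower L)) (poly (lower K)) lower-eq₊
  lower-eq (suc n) = lower-eq₊ n

-- Expressing chromatic series in the ζₙ

record Expressible (f : Series) : Set where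
  constructor expressible
  field
    polynomial : Polynomial
    expresses  : f ≈ eval polynomial

∑-series : (A → Series) → List A → Series
∑-series F xs = foldr _⊕_ 𝟘 (map F xs)

∑-series-coefficient : ∀ (F : A → Series) xs m e → ∑-series F xs m e ≡ ∑ xs (λ x → F x m e)
∑-series-coefficient F []       m e = refl
∑-series-coefficient F (x ∷ xs) m e = cong (F x m e +_) (∑-series-coefficient F xs m e)

eval-coefficient : ∀ P m e → eval P m e ≡ ∑ P (λ (c , μ) → c * evalMonomial μ m e)
eval-coefficient = ∑-series-coefficient (λ (c , μ) → c · evalMonomial μ)

expressible-≈ : ∀ {f g} → f ≈ g → Expressible g → Expressible f
expressible-≈ f≈g (expressible P g≈) = expressible P (λ m e → trans (f≈g m e) (g≈ m e))

expressible-𝟘 : Expressible 𝟘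
expressible-𝟘 = expressible [] (λ m e → refl)

expressible-⊕ : ∀ {f g} → Expressible f → Expressible g → Expressible (f ⊕ g)
expressible-⊕ {f} {g} (expressible P f≈) (expressible Q g≈) = expressible (P ++ Q) (λ m e → begin
  f m e + g m e                                                  ≡⟨ cong₂ _+_ (f≈ m e) (g≈ m e) ⟩
  eval P m e + eval Q m e                                        ≡⟨ cong₂ _+_ (eval-coefficient P m e) (eval-coefficient Q m e) ⟩
  ∑ P (λ (c , μ) → c * evalMonomial μ m e) + ∑ Q (λ (c , μ) → c * evalMonomial μ m e)
                                                                 ≡⟨ ∑-++ (λ (c , μ) → c * evalMonomial μ m e) P Q ⟨
  ∑ (P ++ Q) (λ (c , μ) → c * evalMonomial μ m e)                ≡⟨ eval-coefficient (P ++ Q) m e ⟨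
  eval (P ++ Q) m e                                              ∎)

expressible-· : ∀ d {f} → Expressible f → Expressible (d · f)
expressible-· d {f} (expressible P f≈) = expressible Q (λ m e → begin
  d * f m e                                       ≡⟨ cong (d *_) (trans (f≈ m e) (eval-coefficient P m e)) ⟩
  d * ∑ P (λ (c , μ) → c * evalMonomial μ m e)    ≡⟨ ∑-*ˡ d _ P ⟨
  ∑ P (λ (c , μ) → d * (c * evalMonomial μ m e))  ≡⟨ ∑-cong P (λ (c , μ) → sym (*-assoc d c (evalMonomial μ m e))) ⟩
  ∑ P (λ (c , μ) → d * c * evalMonomial μ m e)    ≡⟨ ∑-map _ _ P ⟨
  ∑ Q (λ (c , μ) → c * evalMonomial μ m e)        ≡⟨ eval-coefficient Q m e ⟨
  eval Q m e                                      ∎)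
  where
  Q = map (λ (c , μ) → d * c , μ) P

expressible-∑ : ∀ (F : A → Series) xs → (∀ x → x ∈ˡ xs → Expressible (F x)) → Expressible (∑-series F xs)
expressible-∑ F []       ex = expressible-𝟘
expressible-∑ F (x ∷ xs) ex = expressible-⊕ (ex x (here refl)) (expressible-∑ F xs (λ y y∈ → ex y (there y∈)))

expressible-ζ⊗ : ∀ n .{{_ : ℕ.NonZero n}} {f} → Expressible f → Expressible (ζ n ⊗ f)
expressible-ζ⊗ n {f} (expressible P f≈) = expressible Q (λ m e → begin
  (ζ n ⊗ f) m e
    ≡⟨ ∑-cong (splits e) (λ (α , β) → trans
         (cong (ζ n m α *_) (trans (f≈ m β) (eval-coefficient P m β)))
         (sym (∑-*ˡ (ζ n m α) _ P))) ⟩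
  ∑ (splits e) (λ (α , β) → ∑ P (λ (c , μ) → ζ n m α * (c * evalMonomial μ m β)))
    ≡⟨ ∑-swap _ (splits e) P ⟩
  ∑ P (λ (c , μ) → ∑ (splits e) (λ (α , β) → ζ n m α * (c * evalMonomial μ m β)))
    ≡⟨ ∑-cong P (λ (c , μ) → trans
         (∑-cong (splits e) (λ (α , β) →
            solve 3 (λ z c v → z :* (c :* v) := c :* (z :* v)) refl (ζ n m α) c (evalMonomial μ m β)))
         (∑-*ˡ c _ (splits e))) ⟩
  ∑ P (λ (c , μ) → c * evalMonomial (mkIndex n ∷ μ) m e)
    ≡⟨ ∑-map _ _ P ⟨
  ∑ Q (λ (c , μ) → c * evalMonomial μ m e)
    ≡⟨ eval-coefficient Q m e ⟨
  eval Q m e ∎)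
  where
  Q = map (λ (c , μ) → c , mkIndex n ∷ μ) P

-- ζₐ₊₁ is pₐ₊₁ plus a combination of p₁, …, pₐ.
p⊗-recursion : ∀ a f → p (suc a) ⊗ f ≈
  (ζ (suc a) ⊗ f) ⊕ ((- 1ℚ) · ∑-series (λ b → fromℕ (suc a C suc b) · (p (suc b) ⊗ f)) (upTo a))
p⊗-recursion a f m e = begin
  ∑ (splits e) (λ (α , β) → p (suc a) m α * f m β)
    ≡⟨ ∑-cong (splits e) (λ (α , β) → trans
         (solve 3 (λ z s x → z :* x := (s :+ z) :* x :+ con (- 1ℚ) :* (s :* x)) refl (p (suc a) m α) (S α) (f m β))
         (cong₂ _+_ (cong (_* f m β) (sym (ζ-top α)))
                    (cong (- 1ℚ *_) (trans (sym (∑-*ʳ (f m β) (λ b → fromℕ (suc a C suc b) * p (suc b) m α) (upTo a)))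
                      (∑-cong (upTo a) (λ b → *-assoc (fromℕ (suc a C suc b)) (p (suc b) m α) (f m β))))))) ⟩
  ∑ (splits e) (λ (α , β) → ζ (suc a) m α * f m β +
                            - 1ℚ * ∑ (upTo a) (λ b → fromℕ (suc a C suc b) * (p (suc b) m α * f m β)))
    ≡⟨ ∑-+ (λ (α , β) → ζ (suc a) m α * f m β) _ (splits e) ⟩
  (ζ (suc a) ⊗ f) m e +
  ∑ (splits e) (λ (α , β) → - 1ℚ * ∑ (upTo a) (λ b → fromℕ (suc a C suc b) * (p (suc b) m α * f m β)))
    ≡⟨ cong ((ζ (suc a) ⊗ f) m e +_) (trans
         (∑-*ˡ (- 1ℚ) (λ (α , β) → ∑ (upTo a) (λ b → fromℕ (suc a C suc b) * (p (suc b) m α * f m β))) (splits e))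
         (cong (- 1ℚ *_) (trans (∑-swap _ (splits e) (upTo a)) (trans
           (∑-cong (upTo a) (λ b → ∑-*ˡ (fromℕ (suc a C suc b)) (λ (α , β) → p (suc b) m α * f m β) (splits e)))
           (sym (∑-series-coefficient _ (upTo a) m e)))))) ⟩
  ((ζ (suc a) ⊗ f) ⊕ ((- 1ℚ) · ∑-series (λ b → fromℕ (suc a C suc b) · (p (suc b) ⊗ f)) (upTo a))) m e ∎
  where
  S : Exponent m → ℚ
  S α = ∑ (upTo a) (λ b → fromℕ (suc a C suc b) * p (suc b) m α)
  ζ-top : ∀ α → ζ (suc a) m α ≡ S α + p (suc a) m α
  ζ-top α = begin
    ζ (suc a) m α
      ≡⟨ ∑-series-coefficient (λ b → fromℕ (suc a C suc b) · p (suc b)) (upTo (suc a)) m α ⟩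
    ∑ (upTo (suc a)) (λ b → fromℕ (suc a C suc b) * p (suc b) m α)
      ≡⟨ ∑-upTo-last a (λ b → fromℕ (suc a C suc b) * p (suc b) m α) ⟩
    S α + fromℕ (suc a C suc a) * p (suc a) m α
      ≡⟨ cong (λ c → S α + fromℕ c * p (suc a) m α) (nCn≡1 (suc a)) ⟩
    S α + 1ℚ * p (suc a) m α
      ≡⟨ cong (S α +_) (*-identityˡ (p (suc a) m α)) ⟩
    S α + p (suc a) m α ∎

-- Strong induction on a inverts the triangular relation between the p's and the ζ's. With the
-- factor f carried along throughout, multiplication by a single ζₙ is the only product to be
-- expressed.
expressible-p⊗ : ∀ a {f} → Expressible f → Expressible (p (suc a) ⊗ f)
expressible-p⊗ a {f} ex = go (suc a) a ℕ.≤-refl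
  where
  go : ∀ bound a → a < bound → Expressible (p (suc a) ⊗ f)
  go (suc bound) a (s≤s a≤) = expressible-≈ (p⊗-recursion a f)
    (expressible-⊕ (expressible-ζ⊗ (suc a) ex)
      (expressible-· (- 1ℚ) (expressible-∑ _ (upTo a) (λ b b∈ →
        expressible-· (fromℕ (suc a C suc b)) (go bound b (ℕ.<-≤-trans (∈ˡ.∈-upTo⁻ b∈) a≤))))))

-- Deletion-contraction for vertex-weighted graphs

properᵇ : List (Fin n × Fin n) → Vec (Fin m) n → Bool
properᵇ E κ = all (λ (u , v) → not (does (lookup κ u Fin.≟ lookup κ v))) E

avoids : Fin m → List (Fin n) → Vec (Fin m) n → Bool
avoids c N κ = all (λ u → not (does (c Fin.≟ lookup κ u))) N

-- The vertex v has weight suc (lookup ws v): weights are positive.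
weight : Vec ℕ n → Vec (Fin m) n → Exponent m
weight {m = m} []       []      = replicate m 0
weight         (w ∷ ws) (c ∷ κ) = unit c (suc w) ⊞ weight ws κ

colorSeries : Vec ℕ n → List (Fin n × Fin n) → Series
colorSeries {n} ws E m e = ∑ (allVecs (allFin m) n) (λ κ → ⟦ properᵇ E κ ⟧ * δ (weight ws κ) e)

-- One more vertex, of weight suc w and adjacent to the vertices in N.
starSeries : ℕ → Vec ℕ n → List (Fin n) → List (Fin n × Fin n) → Series
starSeries {n} w ws N E m e = ∑ (allFin m) (λ c → ∑ (allVecs (allFin m) n) (λ κ →
  ⟦ avoids c N κ ∧ properᵇ E κ ⟧ * δ (unit c (suc w) ⊞ weight ws κ) e))

⊞-comm : ∀ (α β : Exponent m) → α ⊞ β ≡ β ⊞ α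
⊞-comm = Vec.zipWith-comm ℕ.+-comm

⊞-assoc : ∀ (α β γ : Exponent m) → (α ⊞ β) ⊞ γ ≡ α ⊞ (β ⊞ γ)
⊞-assoc = Vec.zipWith-assoc ℕ.+-assoc

⊞-identityˡ : ∀ (α : Exponent m) → replicate m 0 ⊞ α ≡ α
⊞-identityˡ = Vec.zipWith-identityˡ ℕ.+-identityˡ

unit-+ : ∀ (c : Fin m) a b → unit c (a ℕ.+ b) ≡ unit c a ⊞ unit c b
unit-+ Fin.zero    a b = cong ((a ℕ.+ b) ∷_) (sym (⊞-identityˡ _))
unit-+ (Fin.suc c) a b = cong (0 ∷_) (unit-+ c a b)

-- Merged weights add. A weight is stored less one, so (w + 1) + (w′ + 1) is stored as (w + 1) + w′;
-- this explains the update `suc w ℕ.+_`.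
weight-merge : ∀ w (ws : Vec ℕ n) u (κ : Vec (Fin m) n) →
               weight (Vec.updateAt ws u (suc w ℕ.+_)) κ ≡ unit (lookup κ u) (suc w) ⊞ weight ws κ
weight-merge w (w′ ∷ ws) Fin.zero (c ∷ κ) = begin
  unit c (suc (suc w ℕ.+ w′)) ⊞ weight ws κ             ≡⟨ cong (λ k → unit c k ⊞ weight ws κ) (sym (ℕ.+-suc (suc w) w′)) ⟩
  unit c (suc w ℕ.+ suc w′) ⊞ weight ws κ               ≡⟨ cong (_⊞ weight ws κ) (unit-+ c (suc w) (suc w′)) ⟩
  (unit c (suc w) ⊞ unit c (suc w′)) ⊞ weight ws κ      ≡⟨ ⊞-assoc (unit c (suc w)) (unit c (suc w′)) (weight ws κ) ⟩
  unit c (suc w) ⊞ (unit c (suc w′) ⊞ weight ws κ)      ∎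
weight-merge w (w′ ∷ ws) (Fin.suc u) (c ∷ κ) = begin
  unit c (suc w′) ⊞ weight (Vec.updateAt ws u (suc w ℕ.+_)) κ ≡⟨ cong (unit c (suc w′) ⊞_) (weight-merge w ws u κ) ⟩
  unit c (suc w′) ⊞ (x ⊞ weight ws κ)                         ≡⟨ ⊞-assoc (unit c (suc w′)) x (weight ws κ) ⟨
  (unit c (suc w′) ⊞ x) ⊞ weight ws κ                         ≡⟨ cong (_⊞ weight ws κ) (⊞-comm (unit c (suc w′)) x) ⟩
  (x ⊞ unit c (suc w′)) ⊞ weight ws κ                         ≡⟨ ⊞-assoc x (unit c (suc w′)) (weight ws κ) ⟩
  x ⊞ (unit c (suc w′) ⊞ weight ws κ)                         ∎
  where
  x = unit (lookup κ u) (suc w)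

-- The extra vertex takes the color of u, and its edges become edges at u. If u occurs in N the
-- merged graph has a loop, and both sides are false.
properᵇ-merge : ∀ u N E (κ : Vec (Fin m) n) →
                properᵇ (map (u ,_) N ++ E) κ ≡ avoids (lookup κ u) N κ ∧ properᵇ E κ
properᵇ-merge u []      E κ = refl
properᵇ-merge u (v ∷ N) E κ = trans (cong (not b ∧_) (properᵇ-merge u N E κ)) (sym (Bool.∧-assoc (not b) (avoids (lookup κ u) N κ) (properᵇ E κ)))
  where b = does (lookup κ u Fin.≟ lookup κ v)

-- A coloring avoiding the neighbours N but not u is one of the graph in which the extra vertex is merged into u.
star-contract : ∀ w (ws : Vec ℕ n) u N E → starSeries w ws (u ∷ N) E ≈
  starSeries w ws N E ⊕ ((- 1ℚ) · colorSeries (Vec.updateAt ws u (suc w ℕ.+_)) (map (u ,_) N ++ E))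
star-contract {n} w ws u N E m e = begin
  starSeries w ws (u ∷ N) E m e
    ≡⟨ ∑-cong (allFin m) (λ c → trans
         (∑-cong κs (λ κ → split (does (c Fin.≟ lookup κ u)) (avoids c N κ) (properᵇ E κ) (δ (unit c (suc w) ⊞ weight ws κ) e)))
         (trans (∑-+ (F c) _ κs)
                (cong (∑ κs (F c) +_) (∑-*ˡ (- 1ℚ) (λ κ → ⟦ does (c Fin.≟ lookup κ u) ⟧ * F c κ) κs)))) ⟩
  ∑ (allFin m) (λ c → ∑ κs (F c) + - 1ℚ * ∑ κs (λ κ → ⟦ does (c Fin.≟ lookup κ u) ⟧ * F c κ))
    ≡⟨ trans (∑-+ (λ c → ∑ κs (F c)) _ (allFin m))
             (cong (starSeries w ws N E m e +_)
                   (∑-*ˡ (- 1ℚ) (λ c → ∑ κs (λ κ → ⟦ does (c Fin.≟ lookup κ u) ⟧ * F c κ)) (allFin m))) ⟩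
  starSeries w ws N E m e + - 1ℚ * ∑ (allFin m) (λ c → ∑ κs (λ κ → ⟦ does (c Fin.≟ lookup κ u) ⟧ * F c κ))
    -- In the subtracted sum the color of the extra vertex must equal that of u; exchanging the sums
    -- eliminates it.
    ≡⟨ cong (λ s → starSeries w ws N E m e + - 1ℚ * s) (trans (∑-swap _ (allFin m) κs) (∑-cong κs merge)) ⟩
  (starSeries w ws N E ⊕ ((- 1ℚ) · colorSeries ws′ (map (u ,_) N ++ E))) m e ∎
  where
  κs = allVecs (allFin m) n
  ws′ = Vec.updateAt ws u (suc w ℕ.+_)
  F : Fin m → Vec (Fin m) n → ℚ
  F c κ = ⟦ avoids c N κ ∧ properᵇ E κ ⟧ * δ (unit c (suc w) ⊞ weight ws κ) e
  split : ∀ b a p d → ⟦ (not b ∧ a) ∧ p ⟧ * d ≡ ⟦ a ∧ p ⟧ * d + - 1ℚ * (⟦ b ⟧ * (⟦ a ∧ p ⟧ * d))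
  split true  a p d = solve 2 (λ q d → con 0ℚ :* d := q :* d :+ con (- 1ℚ) :* (con 1ℚ :* (q :* d))) refl ⟦ a ∧ p ⟧ d
  split false a p d = solve 2 (λ q d → q :* d := q :* d :+ con (- 1ℚ) :* (con 0ℚ :* (q :* d))) refl ⟦ a ∧ p ⟧ d
  merge : ∀ κ → ∑ (allFin m) (λ c → ⟦ does (c Fin.≟ lookup κ u) ⟧ * F c κ) ≡
                ⟦ properᵇ (map (u ,_) N ++ E) κ ⟧ * δ (weight ws′ κ) e
  merge κ = begin
    ∑ (allFin m) (λ c → ⟦ does (c Fin.≟ lookup κ u) ⟧ * F c κ)
      ≡⟨ ∑-cong (allFin m) (λ c → cong (λ b → ⟦ b ⟧ * F c κ)
           (does-⇔ (mk⇔ sym sym) (c Fin.≟ lookup κ u) (lookup κ u Fin.≟ c))) ⟩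
    ∑ (allFin m) (λ c → ⟦ does (lookup κ u Fin.≟ c) ⟧ * F c κ)
      ≡⟨ ∑-pick Fin._≟_ (lookup κ u) (λ c → F c κ) (Unique.allFin⁺ m) (∈ˡ.∈-allFin (lookup κ u)) ⟩
    F (lookup κ u) κ
      ≡⟨ cong₂ (λ b α → ⟦ b ⟧ * δ α e) (properᵇ-merge u N E κ) (weight-merge w ws u κ) ⟨
    ⟦ properᵇ (map (u ,_) N ++ E) κ ⟧ * δ (weight ws′ κ) e ∎

colorTerms : Vec ℕ n → List (Fin n × Fin n) → ∀ m → Terms m
colorTerms {n} ws E m = map (λ κ → ⟦ properᵇ E κ ⟧ , weight ws κ) (allVecs (allFin m) n)

color-coefficient : ∀ (ws : Vec ℕ n) E m e → colorSeries ws E m e ≡ coefficient (colorTerms ws E m) e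
color-coefficient {n} ws E m e = sym (∑-map _ _ (allVecs (allFin m) n))

star-isolated : ∀ w (ws : Vec ℕ n) E → starSeries w ws [] E ≈ p (suc w) ⊗ colorSeries ws E
star-isolated {n} w ws E m e = sym (begin
  ∑ (splits e) (λ (α , β) → p (suc w) m α * colorSeries ws E m β)
    ≡⟨ ∑-cong (splits e) (λ (α , β) → cong₂ _*_ (p-coefficient (suc w) α) (color-coefficient ws E m β)) ⟩
  ∑ (splits e) (λ (α , β) → coefficient (pTerms m (suc w)) α * coefficient (colorTerms ws E m) β)
    ≡⟨ coefficient-⊠ (pTerms m (suc w)) (colorTerms ws E m) e ⟩
  coefficient (pTerms m (suc w) ⊠ colorTerms ws E m) e
    ≡⟨ ∑-cartesian _ _ (pTerms m (suc w)) (colorTerms ws E m) ⟩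
  ∑ (pTerms m (suc w)) (λ (c , α) → ∑ (colorTerms ws E m) (λ (d , β) → c * d * δ (α ⊞ β) e))
    ≡⟨ trans (∑-map _ _ (allFin m)) (∑-cong (allFin m) (λ i → trans (∑-map _ _ (allVecs (allFin m) n))
         (∑-cong (allVecs (allFin m) n) (λ κ → cong (_* δ (unit i (suc w) ⊞ weight ws κ) e) (*-identityˡ ⟦ properᵇ E κ ⟧))))) ⟩
  starSeries w ws [] E m e ∎)

-- Vertex 0 taken out of the graph. Only the effect on properness is recorded, uniformly in the
-- number of colors; parallel edges may give repeated neighbours.
record Split (E : List (Fin (suc n) × Fin (suc n))) : Set where
  constructor split
  field
    neighbours : List (Fin n)
    rest       : List (Fin n × Fin n)
    proper-∷   : ∀ {m} (c : Fin m) κ → properᵇ E (c ∷ κ) ≡ avoids c neighbours κ ∧ properᵇ rest κ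

-- A loop at vertex 0 rules out every coloring. Other loops go to `rest` and are met when their
-- vertex has become the first.
looped-or-split : ∀ (E : List (Fin (suc n) × Fin (suc n))) →
                  (∀ {m} (κ : Vec (Fin m) (suc n)) → properᵇ E κ ≡ false) ⊎ Split E
looped-or-split [] = inj₂ (split [] [] (λ c κ → refl))
looped-or-split ((u , v) ∷ E) with looped-or-split E
... | inj₁ looped = inj₁ (λ κ → trans (cong (_ ∧_) (looped κ)) (Bool.∧-zeroʳ _))
... | inj₂ (split N R proper-∷) with u | v
...   | Fin.zero  | Fin.zero  = inj₁ λ { (c ∷ κ) →
        cong (λ b → not b ∧ properᵇ E (c ∷ κ)) (dec-true (c Fin.≟ c) refl) }
...   | Fin.zero  | Fin.suc v = inj₂ (split (v ∷ N) R (λ c κ →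
        trans (cong (_ ∧_) (proper-∷ c κ)) (sym (Bool.∧-assoc (not (does (c Fin.≟ lookup κ v))) (avoids c N κ) (properᵇ R κ)))))
...   | Fin.suc u | Fin.zero  = inj₂ (split (u ∷ N) R (λ c κ →
        trans (cong₂ _∧_ (cong not (does-⇔ (mk⇔ sym sym) (lookup κ u Fin.≟ c) (c Fin.≟ lookup κ u))) (proper-∷ c κ))
              (sym (Bool.∧-assoc (not (does (c Fin.≟ lookup κ u))) (avoids c N κ) (properᵇ R κ)))))
...   | Fin.suc u | Fin.suc v = inj₂ (split N ((u , v) ∷ R) (λ c κ →
        trans (cong (_ ∧_) (proper-∷ c κ)) (∧-swap _ (avoids c N κ) (properᵇ R κ))))
  where
  ∧-swap : ∀ a b c → a ∧ (b ∧ c) ≡ b ∧ (a ∧ c)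
  ∧-swap a true  c = refl
  ∧-swap a false c = Bool.∧-zeroʳ a

mutual
  -- Vertex 0 becomes a star vertex over the other n. Removing a neighbour leaves a shorter star
  -- and, by contraction, a graph on those n vertices; a star without neighbours splits off a power
  -- sum. So the number of vertices decreases, and within a star the list N.
  expressible-color : ∀ n (ws : Vec ℕ n) E → Expressible (colorSeries ws E)
  expressible-color zero [] [] = expressible [ 1ℚ , [] ] (λ m e →
    cong (_+ 0ℚ) (trans (*-identityˡ _) (trans (δ-sym (replicate m 0) e) (sym (*-identityˡ _)))))
  expressible-color zero [] ((() , _) ∷ _)
  expressible-color (suc n) (w ∷ ws) E with looped-or-split E
  ... | inj₁ looped = expressible-≈ (λ m e → trans
          (∑-cong (allVecs (allFin m) (suc n)) (λ κ → trans
            (cong (λ b → ⟦ b ⟧ * δ (weight (w ∷ ws) κ) e) (looped κ)) (*-zeroˡ (δ (weight (w ∷ ws) κ) e))))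
          (∑-0 (allVecs (allFin m) (suc n))))
        expressible-𝟘
  ... | inj₂ (split N R proper-∷) = expressible-≈ (λ m e → trans
          (∑-cartesian _ _ (allFin m) (allVecs (allFin m) n))
          (∑-cong (allFin m) (λ c → ∑-cong (allVecs (allFin m) n) (λ κ →
            cong (λ b → ⟦ b ⟧ * δ (unit c (suc w) ⊞ weight ws κ) e) (proper-∷ c κ)))))
        (expressible-star n w ws N R)

  expressible-star : ∀ n w (ws : Vec ℕ n) N E → Expressible (starSeries w ws N E)
  expressible-star n w ws []      E =
    expressible-≈ (star-isolated w ws E) (expressible-p⊗ w (expressible-color n ws E))
  expressible-star n w ws (u ∷ N) E = expressible-≈ (star-contract w ws u N E)
    (expressible-⊕ (expressible-star n w ws N E)
      (expressible-· (- 1ℚ) (expressible-color n (Vec.updateAt ws u (suc w ℕ.+_)) (map (u ,_) N ++ E))))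

-- Colorings of induced subgraphs

-- Every coordinate has its own list of values, so subsets and partial colorings remain vectors over
-- all n vertices and induced subgraphs keep the numbering.
choices : Vec (List A) n → List (Vec A n)
choices []       = [ [] ]
choices (as ∷ c) = cartesianProductWith _∷_ as (choices c)

∈-choices⁻ : ∀ (c : Vec (List A) n) {κ} → κ ∈ˡ choices c → ∀ i → lookup κ i ∈ˡ lookup c i
∈-choices⁻ (as ∷ c) κ∈ i with ∈ˡ.∈-cartesianProductWith⁻ _∷_ as (choices c) κ∈
∈-choices⁻ (as ∷ c) κ∈ Fin.zero    | x , κ , x∈ , κ∈′ , refl = x∈
∈-choices⁻ (as ∷ c) κ∈ (Fin.suc i) | x , κ , x∈ , κ∈′ , refl = ∈-choices⁻ c κ∈′ i

-- A set W of vertices is given by its indicator vector.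
subsets : Vec Bool n → List (Vec Bool n)
subsets W = choices (Vec.map (λ w → if w then true ∷ false ∷ [] else [ false ]) W)

_∖_ : Vec Bool n → Vec Bool n → Vec Bool n
_∖_ = zipWith (λ w s → w ∧ not s)

-- The vertices outside W get no color.
colorings : ∀ m → Vec Bool n → List (Vec (Maybe (Fin m)) n)
colorings m W = choices (Vec.map (λ w → if w then map just (allFin m) else [ nothing ]) W)

∑-subsets-true : ∀ (W : Vec Bool n) h →
  ∑ (subsets (true ∷ W)) h ≡ ∑ (subsets W) (λ S → h (true ∷ S)) + ∑ (subsets W) (λ S → h (false ∷ S))
∑-subsets-true W h = trans (∑-cartesian h _∷_ (true ∷ false ∷ []) (subsets W))
  (cong (∑ (subsets W) (λ S → h (true ∷ S)) +_) (+-identityʳ _))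

∑-subsets-false : ∀ (W : Vec Bool n) h → ∑ (subsets (false ∷ W)) h ≡ ∑ (subsets W) (λ S → h (false ∷ S))
∑-subsets-false W h = trans (∑-cartesian h _∷_ [ false ] (subsets W)) (+-identityʳ _)

∑-colorings-true : ∀ m (W : Vec Bool n) h →
  ∑ (colorings m (true ∷ W)) h ≡ ∑ (allFin m) (λ c → ∑ (colorings m W) (λ κ → h (just c ∷ κ)))
∑-colorings-true m W h = trans (∑-cartesian h _∷_ (map just (allFin m)) (colorings m W)) (∑-map _ just (allFin m))

∑-colorings-false : ∀ m (W : Vec Bool n) h →
  ∑ (colorings m (false ∷ W)) h ≡ ∑ (colorings m W) (λ κ → h (nothing ∷ κ))
∑-colorings-false m W h = trans (∑-cartesian h _∷_ [ nothing ] (colorings m W)) (+-identityʳ _)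

∈-subsets⁻ : ∀ (W : Vec Bool n) {S} → S ∈ˡ subsets W → ∀ i → lookup S i ≡ true → lookup W i ≡ true
∈-subsets⁻ W {S} S∈ i Si = member (lookup W i)
  (subst (lookup S i ∈ˡ_) (Vec.lookup-map i _ W) (∈-choices⁻ (Vec.map _ W) S∈ i)) Si
  where
  member : ∀ w {s} → s ∈ˡ (if w then true ∷ false ∷ [] else [ false ]) → s ≡ true → w ≡ true
  member true  _         _    = refl
  member false (here ()) refl

∈-colorings⁻ : ∀ m (W : Vec Bool n) {κ} → κ ∈ˡ colorings m W → ∀ i → lookup W i ≡ false → lookup κ i ≡ nothing
∈-colorings⁻ m W {κ} κ∈ i Wi = member
  (subst (λ w → lookup κ i ∈ˡ (if w then map just (allFin m) else [ nothing ])) Wi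
    (subst (lookup κ i ∈ˡ_) (Vec.lookup-map i _ W) (∈-choices⁻ (Vec.map _ W) κ∈ i)))
  where
  member : ∀ {k} → k ∈ˡ [ nothing ] → k ≡ nothing
  member (here eq) = eq

insert : Bool → Maybe (Fin m) → Maybe (Fin (suc m))
insert true  _ = just Fin.zero
insert false x = Maybe.map Fin.suc x

-- The vertices of the first color form a subset S; the other vertices of W use the remaining m
-- colors, which `insert` shifts by one.
∑-colorings-suc : ∀ m (W : Vec Bool n) h → ∑ (colorings (suc m) W) h ≡
  ∑ (subsets W) (λ S → ∑ (colorings m (W ∖ S)) (λ κ → h (zipWith insert S κ)))
∑-colorings-suc m []          h = sym (+-identityʳ (h [] + 0ℚ))
∑-colorings-suc m (false ∷ W) h = begin
  ∑ (colorings (suc m) (false ∷ W)) h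
    ≡⟨ ∑-colorings-false (suc m) W h ⟩
  ∑ (colorings (suc m) W) (λ κ → h (nothing ∷ κ))
    ≡⟨ ∑-colorings-suc m W (λ κ → h (nothing ∷ κ)) ⟩
  ∑ (subsets W) (λ S → ∑ (colorings m (W ∖ S)) (λ κ → h (nothing ∷ zipWith insert S κ)))
    ≡⟨ ∑-cong (subsets W) (λ S → sym (∑-colorings-false m (W ∖ S) (λ κ → h (zipWith insert (false ∷ S) κ)))) ⟩
  ∑ (subsets W) (λ S → ∑ (colorings m (false ∷ (W ∖ S))) (λ κ → h (zipWith insert (false ∷ S) κ)))
    ≡⟨ ∑-subsets-false W _ ⟨
  ∑ (subsets (false ∷ W)) (λ S → ∑ (colorings m ((false ∷ W) ∖ S)) (λ κ → h (zipWith insert S κ))) ∎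
∑-colorings-suc m (true ∷ W)  h = begin
  ∑ (colorings (suc m) (true ∷ W)) h
    ≡⟨ ∑-colorings-true (suc m) W h ⟩
  ∑ (allFin (suc m)) (λ c → ∑ (colorings (suc m) W) (λ κ → h (just c ∷ κ)))
    ≡⟨ ∑-allFin m (λ c → ∑ (colorings (suc m) W) (λ κ → h (just c ∷ κ))) ⟩
  ∑ (colorings (suc m) W) (λ κ → h (just Fin.zero ∷ κ)) +
  ∑ (allFin m) (λ c → ∑ (colorings (suc m) W) (λ κ → h (just (Fin.suc c) ∷ κ)))
    ≡⟨ cong₂ _+_ first others ⟩
  ∑ (subsets W) (λ S → F (true ∷ S)) + ∑ (subsets W) (λ S → F (false ∷ S))
    ≡⟨ ∑-subsets-true W F ⟨
  ∑ (subsets (true ∷ W)) F ∎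
  where
  F : Vec Bool _ → ℚ
  F S = ∑ (colorings m ((true ∷ W) ∖ S)) (λ κ → h (zipWith insert S κ))
  first : ∑ (colorings (suc m) W) (λ κ → h (just Fin.zero ∷ κ)) ≡ ∑ (subsets W) (λ S → F (true ∷ S))
  first = trans (∑-colorings-suc m W (λ κ → h (just Fin.zero ∷ κ)))
    (∑-cong (subsets W) (λ S → sym (∑-colorings-false m (W ∖ S) (λ κ → h (zipWith insert (true ∷ S) κ)))))
  others : ∑ (allFin m) (λ c → ∑ (colorings (suc m) W) (λ κ → h (just (Fin.suc c) ∷ κ))) ≡
           ∑ (subsets W) (λ S → F (false ∷ S))
  others = begin
    ∑ (allFin m) (λ c → ∑ (colorings (suc m) W) (λ κ → h (just (Fin.suc c) ∷ κ)))
      ≡⟨ ∑-cong (allFin m) (λ c → ∑-colorings-suc m W (λ κ → h (just (Fin.suc c) ∷ κ))) ⟩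
    ∑ (allFin m) (λ c → ∑ (subsets W) (λ S → ∑ (colorings m (W ∖ S)) (λ κ → h (just (Fin.suc c) ∷ zipWith insert S κ))))
      ≡⟨ ∑-swap _ (allFin m) (subsets W) ⟩
    ∑ (subsets W) (λ S → ∑ (allFin m) (λ c → ∑ (colorings m (W ∖ S)) (λ κ → h (just (Fin.suc c) ∷ zipWith insert S κ))))
      ≡⟨ ∑-cong (subsets W) (λ S → sym (∑-colorings-true m (W ∖ S) (λ κ → h (zipWith insert (false ∷ S) κ)))) ⟩
    ∑ (subsets W) (λ S → F (false ∷ S)) ∎

-- An uncolored vertex clashes with none, so testing all of E on a coloring of W tests precisely the
-- edges inside W.
clash : Maybe (Fin m) → Maybe (Fin m) → Bool
clash (just c) (just d) = does (c Fin.≟ d)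
clash (just c) nothing  = false
clash nothing  _        = false

properᴹ : List (Fin n × Fin n) → Vec (Maybe (Fin m)) n → Bool
properᴹ E κ = all (λ (u , v) → not (clash (lookup κ u) (lookup κ v))) E

stable : List (Fin n × Fin n) → Vec Bool n → Bool
stable E S = all (λ (u , v) → not (lookup S u ∧ lookup S v)) E

_^^_ : ℚ → Vec Bool n → ℚ
x ^^ []          = 1ℚ
x ^^ (true ∷ S)  = x * x ^^ S
x ^^ (false ∷ S) = x ^^ S

colorWeight : Vec ℚ m → Vec (Maybe (Fin m)) n → ℚ
colorWeight y []            = 1ℚ
colorWeight y (just c ∷ κ)  = lookup y c * colorWeight y κ
colorWeight y (nothing ∷ κ) = colorWeight y κ

-- `insert` would overwrite a color present on S and lose its factor; the hypothesis excludes this.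
colorWeight-insert : ∀ x (y : Vec ℚ m) (S : Vec Bool n) κ →
  (∀ i → lookup S i ≡ true → lookup κ i ≡ nothing) →
  colorWeight (x ∷ y) (zipWith insert S κ) ≡ x ^^ S * colorWeight y κ
colorWeight-insert x y []          []      S∩κ = refl
colorWeight-insert x y (true ∷ S)  (k ∷ κ) S∩κ with S∩κ Fin.zero refl
... | refl = trans (cong (x *_) (colorWeight-insert x y S κ (S∩κ ∘ Fin.suc))) (sym (*-assoc x (x ^^ S) (colorWeight y κ)))
colorWeight-insert x y (false ∷ S) (just c ∷ κ) S∩κ =
  trans (cong (lookup y c *_) (colorWeight-insert x y S κ (S∩κ ∘ Fin.suc)))
        (solve 3 (λ a b c → a :* (b :* c) := b :* (a :* c)) refl (lookup y c) (x ^^ S) (colorWeight y κ))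
colorWeight-insert x y (false ∷ S) (nothing ∷ κ) S∩κ = colorWeight-insert x y S κ (S∩κ ∘ Fin.suc)

clash-insert : ∀ s s′ (k k′ : Maybe (Fin m)) → (s ≡ true → k ≡ nothing) → (s′ ≡ true → k′ ≡ nothing) →
               not (clash (insert s k) (insert s′ k′)) ≡ not (s ∧ s′) ∧ not (clash k k′)
clash-insert true  true  k        k′        f f′ = refl
clash-insert true  false k        nothing   f f′ rewrite f refl = refl
clash-insert true  false k        (just c)  f f′ rewrite f refl = refl
clash-insert false true  (just c) k′        f f′ rewrite f′ refl = refl
clash-insert false true  nothing  k′        f f′ = refl
clash-insert false false (just c) (just c′) f f′ = refl
clash-insert false false (just c) nothing   f f′ = refl
clash-insert false false nothing  k′        f f′ = refl

properᴹ-insert : ∀ E (S : Vec Bool n) (κ : Vec (Maybe (Fin m)) n) →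
  (∀ i → lookup S i ≡ true → lookup κ i ≡ nothing) →
  properᴹ E (zipWith insert S κ) ≡ stable E S ∧ properᴹ E κ
properᴹ-insert []            S κ S∩κ = refl
properᴹ-insert ((u , v) ∷ E) S κ S∩κ
  rewrite Vec.lookup-zipWith insert u S κ | Vec.lookup-zipWith insert v S κ
        | clash-insert (lookup S u) (lookup S v) (lookup κ u) (lookup κ v) (S∩κ u) (S∩κ v)
        | properᴹ-insert E S κ S∩κ =
  ∧-interchange (not (lookup S u ∧ lookup S v)) (not (clash (lookup κ u) (lookup κ v))) (stable E S) (properᴹ E κ)
  where
  ∧-interchange : ∀ a b c d → (a ∧ b) ∧ (c ∧ d) ≡ (a ∧ c) ∧ (b ∧ d)
  ∧-interchange true  b true  d = refl
  ∧-interchange true  b false d = Bool.∧-zeroʳ b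
  ∧-interchange false b c     d = refl

isEmpty : Vec Bool n → Bool
isEmpty []          = true
isEmpty (true ∷ W)  = false
isEmpty (false ∷ W) = isEmpty W

module _ {n} (E : List (Fin n × Fin n)) where

  -- The chromatic symmetric function of the subgraph induced on W, evaluated at y. With m entries
  -- -1 it is (-1)^|W| times the number of proper colorings of W in m colors.
  chromatic : Vec ℚ m → Vec Bool n → ℚ
  chromatic {m} y W = ∑ (colorings m W) (λ κ → ⟦ properᴹ E κ ⟧ * colorWeight y κ)

  -- S is the class of the first color: it has to be stable, and each of its vertices contributes a
  -- factor x.
  chromatic-∷ : ∀ x (y : Vec ℚ m) W → chromatic (x ∷ y) W ≡
                ∑ (subsets W) (λ S → ⟦ stable E S ⟧ * x ^^ S * chromatic y (W ∖ S))
  chromatic-∷ {m} x y W = trans (∑-colorings-suc m W _) (∑-cong (subsets W) (λ S → trans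
    (∑-cong-∈ (colorings m (W ∖ S)) (λ κ κ∈ → term S κ (λ i Si → ∈-colorings⁻ m (W ∖ S) κ∈ i
      (trans (Vec.lookup-zipWith _ i W S) (trans (cong (λ s → lookup W i ∧ not s) Si) (Bool.∧-zeroʳ (lookup W i)))))))
    (∑-*ˡ (⟦ stable E S ⟧ * x ^^ S) (λ κ → ⟦ properᴹ E κ ⟧ * colorWeight y κ) (colorings m (W ∖ S)))))
    where
    term : ∀ S κ → (∀ i → lookup S i ≡ true → lookup κ i ≡ nothing) →
           ⟦ properᴹ E (zipWith insert S κ) ⟧ * colorWeight (x ∷ y) (zipWith insert S κ) ≡
           ⟦ stable E S ⟧ * x ^^ S * (⟦ properᴹ E κ ⟧ * colorWeight y κ)
    term S κ S∩κ = trans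
      (cong₂ _*_ (trans (cong ⟦_⟧ (properᴹ-insert E S κ S∩κ)) (⟦∧⟧ (stable E S) (properᴹ E κ))) (colorWeight-insert x y S κ S∩κ))
      (solve 4 (λ a b c d → (a :* b) :* (c :* d) := (a :* c) :* (b :* d)) refl
         ⟦ stable E S ⟧ ⟦ properᴹ E κ ⟧ (x ^^ S) (colorWeight y κ))

  chromatic-[] : ∀ W → chromatic [] W ≡ ⟦ isEmpty W ⟧
  chromatic-[] W = trans (∑-cong (colorings 0 W) (λ κ → cong₂ (λ b r → ⟦ b ⟧ * r) (proper E κ) (weight-1 κ))) (sum W)
    where
    proper : ∀ E (κ : Vec (Maybe (Fin 0)) n) → properᴹ E κ ≡ true
    proper []            κ = refl
    proper ((u , v) ∷ E) κ with lookup κ u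
    ... | nothing = proper E κ
    weight-1 : ∀ {n} (κ : Vec (Maybe (Fin 0)) n) → colorWeight [] κ ≡ 1ℚ
    weight-1 []            = refl
    weight-1 (nothing ∷ κ) = weight-1 κ
    sum : ∀ {n} (W : Vec Bool n) → ∑ (colorings 0 W) (λ _ → 1ℚ * 1ℚ) ≡ ⟦ isEmpty W ⟧
    sum []          = refl
    sum (true ∷ W)  = ∑-colorings-true 0 W (λ _ → 1ℚ * 1ℚ)
    sum (false ∷ W) = trans (∑-colorings-false 0 W (λ _ → 1ℚ * 1ℚ)) (sum W)

  chromatic-full : ∀ (y : Vec ℚ m) → chromatic y (replicate n true) ≡
    ∑ (allVecs (allFin m) n) (λ κ → ⟦ properᵇ E κ ⟧ * ∏^ y (weight (replicate n 0) κ))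
  chromatic-full {m} y = trans (full n _)
    (∑-cong (allVecs (allFin m) n) (λ κ → cong₂ (λ b r → ⟦ b ⟧ * r) (proper E κ) (weight-just κ)))
    where
    full : ∀ n (h : Vec (Maybe (Fin m)) n → ℚ) →
           ∑ (colorings m (replicate n true)) h ≡ ∑ (allVecs (allFin m) n) (h ∘ Vec.map just)
    full zero    h = refl
    full (suc n) h = trans (∑-colorings-true m (replicate n true) h) (trans
      (∑-cong (allFin m) (λ c → full n (λ κ → h (just c ∷ κ))))
      (sym (∑-cartesian (h ∘ Vec.map just) _∷_ (allFin m) (allVecs (allFin m) n))))
    proper : ∀ E (κ : Vec (Fin m) n) → properᴹ E (Vec.map just κ) ≡ properᵇ E κ
    proper []            κ = refl
    proper ((u , v) ∷ E) κ rewrite Vec.lookup-map u just κ | Vec.lookup-map v just κ | proper E κ = refl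
    weight-just : ∀ {n} (κ : Vec (Fin m) n) → colorWeight y (Vec.map just κ) ≡ ∏^ y (weight (replicate n 0) κ)
    weight-just []      = sym (∏^-0 y)
    weight-just {suc n} (c ∷ κ) = trans
      (cong₂ _*_ (trans (sym (*-identityʳ (lookup y c))) (sym (∏^-unit y c 1))) (weight-just κ))
      (sym (∏^-⊞ y (unit c 1) (weight (replicate n 0) κ)))

-- Acyclic orientations of induced subgraphs

Digraph : ℕ → Set
Digraph n = List (Fin n × Fin n)

_⟶⟨_⟩_ : Fin n → Digraph n → Fin n → Set
u ⟶⟨ D ⟩ v = (u , v) ∈ˡ D

IsAcyclic : Digraph n → Set
IsAcyclic D = ∀ v → ¬ TransClosure (_⟶⟨ D ⟩_) v v

isAcyclic? : ∀ (D : Digraph n) → Dec (IsAcyclic D)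
isAcyclic? D = Fin.all? (λ v → ¬? (Reachability.reachable? (λ u v → (u , v) ∈? D) v v))
  where open ListMembership (≡-dec Fin._≟_ Fin._≟_) using (_∈?_)

acyclicᵇ : Digraph n → Bool
acyclicᵇ D = does (isAcyclic? D)

all⁺ : ∀ (f : A → Bool) xs → (∀ x → x ∈ˡ xs → f x ≡ true) → all f xs ≡ true
all⁺ f []       h = refl
all⁺ f (x ∷ xs) h = cong₂ _∧_ (h x (here refl)) (all⁺ f xs (λ y y∈ → h y (there y∈)))

all⁻ : ∀ (f : A → Bool) xs → all f xs ≡ true → ∀ x → x ∈ˡ xs → f x ≡ true
all⁻ f (y ∷ xs) h x x∈ with f y in fy
all⁻ f (y ∷ xs) h x (here refl) | true = fy
all⁻ f (y ∷ xs) h x (there x∈)  | true = all⁻ f xs h x x∈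

¬all⁻ : ∀ (f : A → Bool) xs → all f xs ≡ false → ∃[ x ] x ∈ˡ xs × f x ≡ false
¬all⁻ f (x ∷ xs) h with f x in fx
... | false = x , here refl , fx
... | true  with y , y∈ , fy ← ¬all⁻ f xs h = y , there y∈ , fy

noTailIn : Vec Bool n → Digraph n → Bool
noTailIn S = all (λ (a , b) → not (lookup S a))

outside : Vec Bool n → Fin n × Fin n → Bool
outside S (a , b) = not (lookup S a) ∧ not (lookup S b)

inside : Vec Bool n → Fin n × Fin n → Bool
inside W (a , b) = lookup W a ∧ lookup W b

orientationsOf : Digraph n → List (Digraph n)
orientationsOf []            = [ [] ]
orientationsOf ((u , v) ∷ E) = map ((u , v) ∷_) (orientationsOf E) ++ map ((v , u) ∷_) (orientationsOf E)

∑-orientations-∷ : ∀ u v (E : Digraph n) h → ∑ (orientationsOf ((u , v) ∷ E)) h ≡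
  ∑ (orientationsOf E) (λ D → h ((u , v) ∷ D)) + ∑ (orientationsOf E) (λ D → h ((v , u) ∷ D))
∑-orientations-∷ u v E h = trans (∑-++ h (map ((u , v) ∷_) (orientationsOf E)) _)
  (cong₂ _+_ (∑-map h ((u , v) ∷_) (orientationsOf E)) (∑-map h ((v , u) ∷_) (orientationsOf E)))

∈-orientations⁻ : ∀ (E : Digraph n) {D} → D ∈ˡ orientationsOf E → ∀ {a b} → (a , b) ∈ˡ D →
                  (a , b) ∈ˡ E ⊎ (b , a) ∈ˡ E
∈-orientations⁻ []            (here refl) ()
∈-orientations⁻ ((u , v) ∷ E) D∈ a∈ with ∈ˡ.∈-++⁻ (map ((u , v) ∷_) (orientationsOf E)) D∈
... | inj₁ D∈₁ with ∈ˡ.∈-map⁻ ((u , v) ∷_) D∈₁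
...   | D , D∈E , refl with a∈
...     | here refl = inj₁ (here refl)
...     | there a∈D = Sum.map there there (∈-orientations⁻ E D∈E a∈D)
∈-orientations⁻ ((u , v) ∷ E) D∈ a∈ | inj₂ D∈₂ with ∈ˡ.∈-map⁻ ((v , u) ∷_) D∈₂
...   | D , D∈E , refl with a∈
...     | here refl = inj₂ (here refl)
...     | there a∈D = Sum.map there there (∈-orientations⁻ E D∈E a∈D)

-- Making all of S sinks forces every edge at S and is impossible if an edge has both ends in S.
∑-orientations-sinks : ∀ (E : Digraph n) S h →
  ∑ (orientationsOf E) (λ D → ⟦ noTailIn S D ⟧ * h (filterᵇ (outside S) D)) ≡
  ⟦ stable E S ⟧ * ∑ (orientationsOf (filterᵇ (outside S) E)) h
∑-orientations-sinks []            S h = trans (+-identityʳ _) (cong (1ℚ *_) (sym (+-identityʳ (h []))))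
∑-orientations-sinks ((u , v) ∷ E) S h = trans
  (∑-orientations-∷ u v E (λ D → ⟦ noTailIn S D ⟧ * h (filterᵇ (outside S) D))) (ends (lookup S u) (lookup S v) refl refl)
  where
  G : Digraph _ → ℚ
  G D = ⟦ noTailIn S D ⟧ * h (filterᵇ (outside S) D)
  ends : ∀ s s′ → lookup S u ≡ s → lookup S v ≡ s′ →
    ∑ (orientationsOf E) (λ D → G ((u , v) ∷ D)) + ∑ (orientationsOf E) (λ D → G ((v , u) ∷ D)) ≡
    ⟦ stable ((u , v) ∷ E) S ⟧ * ∑ (orientationsOf (filterᵇ (outside S) ((u , v) ∷ E))) h
  ends true true eq eq′ rewrite eq | eq′ = begin
    ∑ (orientationsOf E) (λ D → 0ℚ * h (filterᵇ (outside S) D)) + ∑ (orientationsOf E) (λ D → 0ℚ * h (filterᵇ (outside S) D))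
      ≡⟨ cong₂ _+_ zeros zeros ⟩
    0ℚ
      ≡⟨ *-zeroˡ (∑ (orientationsOf (filterᵇ (outside S) E)) h) ⟨
    0ℚ * ∑ (orientationsOf (filterᵇ (outside S) E)) h ∎
    where
    zeros : ∑ (orientationsOf E) (λ D → 0ℚ * h (filterᵇ (outside S) D)) ≡ 0ℚ
    zeros = trans (∑-cong (orientationsOf E) (λ D → *-zeroˡ (h (filterᵇ (outside S) D)))) (∑-0 (orientationsOf E))
  -- Only v → u keeps u a sink, and that arrow is filtered out because it meets S.
  ends true false eq eq′ rewrite eq | eq′ = trans
    (cong₂ _+_ (trans (∑-cong (orientationsOf E) (λ D → *-zeroˡ (h (filterᵇ (outside S) D)))) (∑-0 (orientationsOf E)))
               (∑-orientations-sinks E S h))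
    (+-identityˡ _)
  ends false true eq eq′ rewrite eq | eq′ = trans
    (cong₂ _+_ (∑-orientations-sinks E S h)
               (trans (∑-cong (orientationsOf E) (λ D → *-zeroˡ (h (filterᵇ (outside S) D)))) (∑-0 (orientationsOf E))))
    (+-identityʳ _)
  -- Both directions pass the filter, so the arrow is absorbed into h.
  ends false false eq eq′ rewrite eq | eq′ = trans
    (cong₂ _+_ (∑-orientations-sinks E S (λ D → h ((u , v) ∷ D))) (∑-orientations-sinks E S (λ D → h ((v , u) ∷ D))))
    (trans (sym (*-distribˡ-+ ⟦ stable E S ⟧ _ _))
           (cong (⟦ stable E S ⟧ *_) (sym (∑-orientations-∷ u v (filterᵇ (outside S) E) h))))

T⇒≡ : ∀ {b} → T b → b ≡ true
T⇒≡ {true} _ = refl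

≡⇒T : ∀ {b} → b ≡ true → T b
≡⇒T refl = _

∈-filterᵇ⁺ : ∀ (f : A → Bool) {x xs} → x ∈ˡ xs → f x ≡ true → x ∈ˡ filterᵇ f xs
∈-filterᵇ⁺ f x∈ fx = ∈ˡ.∈-filter⁺ (T? ∘ f) x∈ (≡⇒T fx)

∈-filterᵇ⁻ : ∀ (f : A → Bool) {x xs} → x ∈ˡ filterᵇ f xs → x ∈ˡ xs × f x ≡ true
∈-filterᵇ⁻ f x∈ with x∈xs , Tfx ← ∈ˡ.∈-filter⁻ (T? ∘ f) x∈ = x∈xs , T⇒≡ Tfx

plus-map : ∀ {R R′ : A → A → Set} → (∀ {u v} → R u v → R′ u v) →
           ∀ {u v} → TransClosure R u v → TransClosure R′ u v
plus-map f Plus.[ r ]     = Plus.[ f r ]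
plus-map f (r Plus.∷ r⁺) = f r Plus.∷ plus-map f r⁺

-- A cycle does not pass through a sink.
acyclic-outside : ∀ (D : Digraph n) S → noTailIn S D ≡ true → acyclicᵇ D ≡ acyclicᵇ (filterᵇ (outside S) D)
acyclic-outside D S sinks = does-⇔ (mk⇔
  (λ ac v cyc → ac v (plus-map (proj₁ ∘ ∈-filterᵇ⁻ (outside S)) cyc))
  (λ ac v cyc → ac v (restrict cyc (start-outside cyc))))
  (isAcyclic? D) (isAcyclic? (filterᵇ (outside S) D))
  where
  tail-outside : ∀ {u v} → u ⟶⟨ D ⟩ v → not (lookup S u) ≡ true
  tail-outside = all⁻ _ D sinks _
  start-outside : ∀ {u v} → TransClosure (_⟶⟨ D ⟩_) u v → not (lookup S u) ≡ true
  start-outside Plus.[ r ]     = tail-outside r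
  start-outside (r Plus.∷ r⁺) = tail-outside r
  restrict : ∀ {u v} → TransClosure (_⟶⟨ D ⟩_) u v → not (lookup S v) ≡ true →
             TransClosure (_⟶⟨ filterᵇ (outside S) D ⟩_) u v
  restrict Plus.[ r ]     v∉ = Plus.[ ∈-filterᵇ⁺ (outside S) r (cong₂ _∧_ (tail-outside r) v∉) ]
  restrict (r Plus.∷ r⁺) v∉ = ∈-filterᵇ⁺ (outside S) r (cong₂ _∧_ (tail-outside r) (start-outside r⁺)) Plus.∷ restrict r⁺ v∉

-- Sinks of acyclic orientations

sinkᵇ : Digraph n → Fin n → Bool
sinkᵇ D v = all (λ (a , b) → not (does (a Fin.≟ v))) D

sinkVec : Digraph n → Vec Bool n
sinkVec D = tabulate (sinkᵇ D)

_⊆ᵇ_ : Vec Bool n → Vec Bool n → Bool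
[]      ⊆ᵇ []      = true
(s ∷ S) ⊆ᵇ (b ∷ B) = (not s ∨ b) ∧ (S ⊆ᵇ B)

⊆ᵇ⁺ : ∀ (S B : Vec Bool n) → (∀ v → lookup S v ≡ true → lookup B v ≡ true) → (S ⊆ᵇ B) ≡ true
⊆ᵇ⁺ []          []      h = refl
⊆ᵇ⁺ (true ∷ S)  (b ∷ B) h = cong₂ _∧_ (h Fin.zero refl) (⊆ᵇ⁺ S B (h ∘ Fin.suc))
⊆ᵇ⁺ (false ∷ S) (b ∷ B) h = ⊆ᵇ⁺ S B (h ∘ Fin.suc)

⊆ᵇ⁻ : ∀ (S B : Vec Bool n) → (S ⊆ᵇ B) ≡ true → ∀ v → lookup S v ≡ true → lookup B v ≡ true
⊆ᵇ⁻ (true ∷ S)  (true ∷ B) h Fin.zero    Sv = refl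
⊆ᵇ⁻ (true ∷ S)  (true ∷ B) h (Fin.suc v) Sv = ⊆ᵇ⁻ S B h v Sv
⊆ᵇ⁻ (false ∷ S) (b ∷ B)    h (Fin.suc v) Sv = ⊆ᵇ⁻ S B h v Sv

bool-ext : ∀ {a b} → (a ≡ true → b ≡ true) → (b ≡ true → a ≡ true) → a ≡ b
bool-ext {true}          f g = sym (f refl)
bool-ext {false} {true}  f g = g refl
bool-ext {false} {false} f g = refl

noTailIn-sinkVec : ∀ S (D : Digraph n) → noTailIn S D ≡ (S ⊆ᵇ sinkVec D)
noTailIn-sinkVec S D = bool-ext
  (λ noTail → ⊆ᵇ⁺ S (sinkVec D) (λ v Sv → trans (Vec.lookup∘tabulate (sinkᵇ D) v)
    (all⁺ _ D (λ (a , b) ab∈ → cong not (dec-false (a Fin.≟ v)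
      (λ { refl → true≢false (trans (sym (cong not Sv)) (all⁻ _ D noTail _ ab∈)) }))))))
  (λ S⊆ → all⁺ _ D (λ (a , b) ab∈ → no-tail a b ab∈ S⊆ (lookup S a) refl))
  where
  true≢false : false ≡ true → ⊥
  true≢false ()
  no-tail : ∀ a b → (a , b) ∈ˡ D → (S ⊆ᵇ sinkVec D) ≡ true → ∀ s → lookup S a ≡ s → not (lookup S a) ≡ true
  no-tail a b ab∈ S⊆ false Sa = cong not Sa
  no-tail a b ab∈ S⊆ true  Sa = ⊥-elim (true≢false (trans (sym (cong not (dec-true (a Fin.≟ a) refl)))
    (all⁻ _ D (trans (sym (Vec.lookup∘tabulate (sinkᵇ D) a)) (⊆ᵇ⁻ S (sinkVec D) S⊆ a Sa)) _ ab∈)))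

-- The power of 1 + x with exponent |W ∩ B|, written as a product over vertices so that it can be
-- expanded into a sum over subsets.
sinkProduct : ℚ → Vec Bool n → Vec Bool n → ℚ
sinkProduct x []      []      = 1ℚ
sinkProduct x (w ∷ W) (b ∷ B) = (if w ∧ b then 1ℚ + x else 1ℚ) * sinkProduct x W B

-- Expanding the product: a vertex of W ∩ B is put into S with factor x or left out with factor 1;
-- any other vertex is left out.
∑-subsets-⊆ : ∀ x (W B : Vec Bool n) → ∑ (subsets W) (λ S → x ^^ S * ⟦ S ⊆ᵇ B ⟧) ≡ sinkProduct x W B
∑-subsets-⊆ x []          []          = refl
∑-subsets-⊆ x (false ∷ W) (b ∷ B)     = trans (∑-subsets-false W (λ S → x ^^ S * ⟦ S ⊆ᵇ (b ∷ B) ⟧))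
  (trans (∑-subsets-⊆ x W B) (sym (*-identityˡ (sinkProduct x W B))))
∑-subsets-⊆ x (true ∷ W)  (true ∷ B)  = begin
  ∑ (subsets (true ∷ W)) (λ S → x ^^ S * ⟦ S ⊆ᵇ (true ∷ B) ⟧)
    ≡⟨ ∑-subsets-true W (λ S → x ^^ S * ⟦ S ⊆ᵇ (true ∷ B) ⟧) ⟩
  ∑ (subsets W) (λ S → x * x ^^ S * ⟦ S ⊆ᵇ B ⟧) + ∑ (subsets W) (λ S → x ^^ S * ⟦ S ⊆ᵇ B ⟧)
    ≡⟨ cong₂ _+_ (trans (∑-cong (subsets W) (λ S → *-assoc x (x ^^ S) ⟦ S ⊆ᵇ B ⟧))
                        (trans (∑-*ˡ x (λ S → x ^^ S * ⟦ S ⊆ᵇ B ⟧) (subsets W)) (cong (x *_) (∑-subsets-⊆ x W B))))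
                 (∑-subsets-⊆ x W B) ⟩
  x * sinkProduct x W B + sinkProduct x W B
    ≡⟨ solve 2 (λ x s → x :* s :+ s := (con 1ℚ :+ x) :* s) refl x (sinkProduct x W B) ⟩
  (1ℚ + x) * sinkProduct x W B ∎
∑-subsets-⊆ x (true ∷ W)  (false ∷ B) = begin
  ∑ (subsets (true ∷ W)) (λ S → x ^^ S * ⟦ S ⊆ᵇ (false ∷ B) ⟧)
    ≡⟨ ∑-subsets-true W (λ S → x ^^ S * ⟦ S ⊆ᵇ (false ∷ B) ⟧) ⟩
  ∑ (subsets W) (λ S → x * x ^^ S * 0ℚ) + ∑ (subsets W) (λ S → x ^^ S * ⟦ S ⊆ᵇ B ⟧)
    ≡⟨ cong₂ _+_ (trans (∑-cong (subsets W) (λ S → *-zeroʳ (x * x ^^ S))) (∑-0 (subsets W))) (∑-subsets-⊆ x W B) ⟩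
  0ℚ + sinkProduct x W B
    ≡⟨ solve 1 (λ s → con 0ℚ :+ s := con 1ℚ :* s) refl (sinkProduct x W B) ⟩
  1ℚ * sinkProduct x W B ∎

-- Out of every vertex of W leads an arrow into W, so a long enough walk repeats a vertex.
cycle : ∀ (D : Digraph n) W → (∀ v → lookup W v ≡ true → ∃[ u ] v ⟶⟨ D ⟩ u × lookup W u ≡ true) →
        ∀ v → lookup W v ≡ true → ¬ IsAcyclic D
cycle {n} D W next v₀ Wv₀ acyclic =
  let i , j , i<j , eq = Fin.pigeonhole (ℕ.n<1+n n) (proj₁ ∘ walk ∘ Fin.toℕ)
      k , 1+i+k≡j      = ℕ.m≤n⇒∃[o]m+o≡n i<j
  in acyclic (proj₁ (walk (Fin.toℕ i))) (subst (TransClosure (_⟶⟨ D ⟩_) _)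
       (trans (cong (proj₁ ∘ walk) (trans (cong suc (ℕ.+-comm k (Fin.toℕ i))) 1+i+k≡j)) (sym eq))
       (path (Fin.toℕ i) k))
  where
  walk : ℕ → ∃[ v ] lookup W v ≡ true
  walk zero    = v₀ , Wv₀
  walk (suc i) = let v , Wv = walk i ; u , _ , Wu = next v Wv in u , Wu
  step : ∀ i → proj₁ (walk i) ⟶⟨ D ⟩ proj₁ (walk (suc i))
  step i = let v , Wv = walk i in proj₁ (proj₂ (next v Wv))
  path : ∀ i k → TransClosure (_⟶⟨ D ⟩_) (proj₁ (walk i)) (proj₁ (walk (suc (k ℕ.+ i))))
  path i zero    = Plus.[ step i ]
  path i (suc k) = path i k Plus.∷ʳ step (suc (k ℕ.+ i))

filter-outside-inside : ∀ W S (E : Digraph n) → filterᵇ (outside S) (filterᵇ (inside W) E) ≡ filterᵇ (inside (W ∖ S)) E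
filter-outside-inside W S []            = refl
filter-outside-inside W S ((u , v) ∷ E)
  rewrite Vec.lookup-zipWith (λ w s → w ∧ not s) u W S | Vec.lookup-zipWith (λ w s → w ∧ not s) v W S
  with lookup W u in eq₁ | lookup W v in eq₂
... | false | _     = filter-outside-inside W S E
... | true  | false rewrite Bool.∧-zeroʳ (not (lookup S u)) = filter-outside-inside W S E
... | true  | true  with lookup S u | lookup S v
...   | true  | _     = filter-outside-inside W S E
...   | false | true  = filter-outside-inside W S E
...   | false | false = cong ((u , v) ∷_) (filter-outside-inside W S E)

⊆-false : ∀ {W S : Vec Bool n} → (∀ v → lookup S v ≡ true → lookup W v ≡ true) →
          ∀ v → lookup W v ≡ false → lookup S v ≡ false
⊆-false S⊆W v Wv = Bool.¬-not (λ Sv → Bool.not-¬ Wv (S⊆W v Sv))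

-- An edge not inside W has an end outside S, as S ⊆ W, so it cannot violate stability.
stable-inside : ∀ W S (E : Digraph n) → (∀ v → lookup S v ≡ true → lookup W v ≡ true) →
                stable (filterᵇ (inside W) E) S ≡ stable E S
stable-inside W S []            S⊆W = refl
stable-inside W S ((u , v) ∷ E) S⊆W with lookup W u in Wu | lookup W v in Wv
... | true  | true  = cong (not (lookup S u ∧ lookup S v) ∧_) (stable-inside W S E S⊆W)
... | true  | false rewrite ⊆-false {W = W} {S} S⊆W v Wv | Bool.∧-zeroʳ (lookup S u) = stable-inside W S E S⊆W
... | false | _     rewrite ⊆-false {W = W} {S} S⊆W u Wu = stable-inside W S E S⊆W

∧-true : ∀ a b → a ∧ b ≡ true → a ≡ true × b ≡ true
∧-true true true refl = refl , refl

module _ {n} (E : Digraph n) where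

  acyclicCount : Vec Bool n → ℚ
  acyclicCount W = ∑ (orientationsOf (filterᵇ (inside W) E)) (λ D → ⟦ acyclicᵇ D ⟧)

  -- Both sides count pairs of an acyclic orientation D on W and a set S ⊆ W of its sinks, weighted
  -- by x^|S|. For fixed S all edges at S are forced, leaving an acyclic orientation of the rest of
  -- W; for fixed D any set of sinks in W may be chosen.
  ∑-stable-acyclic : ∀ x W →
    ∑ (subsets W) (λ S → ⟦ stable E S ⟧ * x ^^ S * acyclicCount (W ∖ S)) ≡
    ∑ (orientationsOf (filterᵇ (inside W) E)) (λ D → ⟦ acyclicᵇ D ⟧ * sinkProduct x W (sinkVec D))
  ∑-stable-acyclic x W = begin
    ∑ (subsets W) (λ S → ⟦ stable E S ⟧ * x ^^ S * acyclicCount (W ∖ S))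
      ≡⟨ ∑-cong-∈ (subsets W) (λ S S∈ → trans
           (solve 3 (λ s x a → (s :* x) :* a := x :* (s :* a)) refl ⟦ stable E S ⟧ (x ^^ S) (acyclicCount (W ∖ S)))
           (cong (x ^^ S *_) (sinks S (∈-subsets⁻ W S∈)))) ⟩
    ∑ (subsets W) (λ S → x ^^ S * ∑ Ds (λ D → ⟦ noTailIn S D ⟧ * ⟦ acyclicᵇ D ⟧))
      ≡⟨ ∑-cong (subsets W) (λ S → sym (∑-*ˡ (x ^^ S) (λ D → ⟦ noTailIn S D ⟧ * ⟦ acyclicᵇ D ⟧) Ds)) ⟩
    ∑ (subsets W) (λ S → ∑ Ds (λ D → x ^^ S * (⟦ noTailIn S D ⟧ * ⟦ acyclicᵇ D ⟧)))
      ≡⟨ ∑-swap _ (subsets W) Ds ⟩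
    ∑ Ds (λ D → ∑ (subsets W) (λ S → x ^^ S * (⟦ noTailIn S D ⟧ * ⟦ acyclicᵇ D ⟧)))
      ≡⟨ ∑-cong Ds (λ D → trans
           (∑-cong (subsets W) (λ S → trans
             (solve 3 (λ x t a → x :* (t :* a) := a :* (x :* t)) refl (x ^^ S) ⟦ noTailIn S D ⟧ ⟦ acyclicᵇ D ⟧)
             (cong (λ b → ⟦ acyclicᵇ D ⟧ * (x ^^ S * ⟦ b ⟧)) (noTailIn-sinkVec S D))))
           (trans (∑-*ˡ ⟦ acyclicᵇ D ⟧ (λ S → x ^^ S * ⟦ S ⊆ᵇ sinkVec D ⟧) (subsets W))
                  (cong (⟦ acyclicᵇ D ⟧ *_) (∑-subsets-⊆ x W (sinkVec D))))) ⟩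
    ∑ Ds (λ D → ⟦ acyclicᵇ D ⟧ * sinkProduct x W (sinkVec D)) ∎
    where
    Ds = orientationsOf (filterᵇ (inside W) E)
    sinks : ∀ S → (∀ v → lookup S v ≡ true → lookup W v ≡ true) →
            ⟦ stable E S ⟧ * acyclicCount (W ∖ S) ≡ ∑ Ds (λ D → ⟦ noTailIn S D ⟧ * ⟦ acyclicᵇ D ⟧)
    sinks S S⊆W = begin
      ⟦ stable E S ⟧ * acyclicCount (W ∖ S)
        ≡⟨ cong₂ (λ b F → ⟦ b ⟧ * ∑ (orientationsOf F) (λ D → ⟦ acyclicᵇ D ⟧))
             (stable-inside W S E S⊆W) (filter-outside-inside W S E) ⟨
      ⟦ stable (filterᵇ (inside W) E) S ⟧ * ∑ (orientationsOf (filterᵇ (outside S) (filterᵇ (inside W) E))) (λ D → ⟦ acyclicᵇ D ⟧)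
        ≡⟨ ∑-orientations-sinks (filterᵇ (inside W) E) S (λ D → ⟦ acyclicᵇ D ⟧) ⟨
      ∑ Ds (λ D → ⟦ noTailIn S D ⟧ * ⟦ acyclicᵇ (filterᵇ (outside S) D) ⟧)
        ≡⟨ ∑-cong Ds (λ D → restrict (noTailIn S D) D refl) ⟩
      ∑ Ds (λ D → ⟦ noTailIn S D ⟧ * ⟦ acyclicᵇ D ⟧) ∎
      where
      restrict : ∀ b D → noTailIn S D ≡ b → ⟦ b ⟧ * ⟦ acyclicᵇ (filterᵇ (outside S) D) ⟧ ≡ ⟦ b ⟧ * ⟦ acyclicᵇ D ⟧
      restrict true  D eq = cong (λ b → 1ℚ * ⟦ b ⟧) (sym (acyclic-outside D S eq))
      restrict false D eq = trans (*-zeroˡ ⟦ acyclicᵇ (filterᵇ (outside S) D) ⟧) (sym (*-zeroˡ ⟦ acyclicᵇ D ⟧))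

  -- A nonempty acyclic digraph has a sink, which contributes the factor 1 + (-1).
  acyclic-sinkless : ∀ W → ∑ (orientationsOf (filterᵇ (inside W) E)) (λ D → ⟦ acyclicᵇ D ⟧ * sinkProduct (- 1ℚ) W (sinkVec D)) ≡
                           ⟦ isEmpty W ⟧
  acyclic-sinkless W with isEmpty W in eq
  ... | true  = trans (cong (λ F → ∑ (orientationsOf F) (λ D → ⟦ acyclicᵇ D ⟧ * sinkProduct (- 1ℚ) W (sinkVec D))) (no-edges E))
    (trans (+-identityʳ _) (trans (cong₂ _*_ (cong ⟦_⟧ acyclic-[]) (product W _ eq)) (*-identityˡ 1ℚ)))
    where
    none : ∀ {n} (W : Vec Bool n) → isEmpty W ≡ true → ∀ v → lookup W v ≡ false
    none (false ∷ W) eq Fin.zero    = refl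
    none (false ∷ W) eq (Fin.suc v) = none W eq v
    no-edges : ∀ E → filterᵇ (inside W) E ≡ []
    no-edges []            = refl
    no-edges ((u , v) ∷ E) rewrite none W eq u = no-edges E
    acyclic-[] : acyclicᵇ {n} [] ≡ true
    acyclic-[] = dec-true (isAcyclic? {n} []) (λ { v Plus.[ () ] ; v (() Plus.∷ _) })
    product : ∀ {n} (W B : Vec Bool n) → isEmpty W ≡ true → sinkProduct (- 1ℚ) W B ≡ 1ℚ
    product []          []      eq = refl
    product (false ∷ W) (b ∷ B) eq = trans (*-identityˡ _) (product W B eq)
  ... | false = trans (∑-cong-∈ Ds vanish) (∑-0 Ds)
    where
    Ds = orientationsOf (filterᵇ (inside W) E)
    some : ∀ {n} (W : Vec Bool n) → isEmpty W ≡ false → ∃[ v ] lookup W v ≡ true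
    some (true ∷ W)  eq = Fin.zero , refl
    some (false ∷ W) eq = let v , Wv = some W eq in Fin.suc v , Wv
    product : ∀ {n} (W B : Vec Bool n) v → lookup W v ≡ true → lookup B v ≡ true → sinkProduct (- 1ℚ) W B ≡ 0ℚ
    product (w ∷ W) (b ∷ B) Fin.zero    refl refl = *-zeroˡ (sinkProduct (- 1ℚ) W B)
    product (w ∷ W) (b ∷ B) (Fin.suc v) Wv   Bv   =
      trans (cong (factor *_) (product W B v Wv Bv)) (*-zeroʳ factor)
      where factor = if w ∧ b then 1ℚ + - 1ℚ else 1ℚ
    vanish : ∀ D → D ∈ˡ Ds → ⟦ acyclicᵇ D ⟧ * sinkProduct (- 1ℚ) W (sinkVec D) ≡ 0ℚ
    -- Vertices outside W are isolated in D and thus sinks, but contribute no factor 1 + x; the sink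
    -- has to be sought inside W.
    vanish D D∈ with Fin.any? (λ v → (lookup W v Bool.≟ true) ×-dec (sinkᵇ D v Bool.≟ true))
    ... | yes (v , Wv , Dv) = trans
          (cong (⟦ acyclicᵇ D ⟧ *_) (product W (sinkVec D) v Wv (trans (Vec.lookup∘tabulate (sinkᵇ D) v) Dv)))
          (*-zeroʳ ⟦ acyclicᵇ D ⟧)
    ... | no noSink = let v , Wv = some W eq in trans
          (cong (λ b → ⟦ b ⟧ * sinkProduct (- 1ℚ) W (sinkVec D)) (dec-false (isAcyclic? D) (cycle D W next v Wv)))
          (*-zeroˡ (sinkProduct (- 1ℚ) W (sinkVec D)))
      where
      head-inside : ∀ {a b} → a ⟶⟨ D ⟩ b → lookup W b ≡ true
      head-inside {a} {b} r with ∈-orientations⁻ (filterᵇ (inside W) E) D∈ r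
      ... | inj₁ ab∈ = proj₂ (∧-true (lookup W a) (lookup W b) (proj₂ (∈-filterᵇ⁻ (inside W) {xs = E} ab∈)))
      ... | inj₂ ba∈ = proj₁ (∧-true (lookup W b) (lookup W a) (proj₂ (∈-filterᵇ⁻ (inside W) {xs = E} ba∈)))
      next : ∀ v → lookup W v ≡ true → ∃[ u ] v ⟶⟨ D ⟩ u × lookup W u ≡ true
      next v Wv with (a , b) , ab∈ , eq ← ¬all⁻ _ D (Bool.¬-not (λ Dv → noSink (v , Wv , Dv))) with a Fin.≟ v
      -- In the other case `eq` would read `true ≡ false`.
      ... | yes refl = b , ab∈ , head-inside ab∈

-- Reciprocity

size : Vec Bool n → ℕ
size []          = 0
size (true ∷ W)  = suc (size W)
size (false ∷ W) = size W

size-∖-≤ : ∀ (W S : Vec Bool n) → size (W ∖ S) ≤ size W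
size-∖-≤ []          []          = z≤n
size-∖-≤ (true ∷ W)  (true ∷ S)  = ℕ.m≤n⇒m≤1+n (size-∖-≤ W S)
size-∖-≤ (true ∷ W)  (false ∷ S) = s≤s (size-∖-≤ W S)
size-∖-≤ (false ∷ W) (s ∷ S)     = size-∖-≤ W S

size-∖-< : ∀ (W S : Vec Bool n) → (∀ v → lookup S v ≡ true → lookup W v ≡ true) → isEmpty S ≡ false →
           size (W ∖ S) < size W
size-∖-< (true ∷ W)  (true ∷ S)  S⊆W nonempty = s≤s (size-∖-≤ W S)
size-∖-< (false ∷ W) (true ∷ S)  S⊆W nonempty with () ← S⊆W Fin.zero refl
size-∖-< (true ∷ W)  (false ∷ S) S⊆W nonempty = s≤s (size-∖-< W S (S⊆W ∘ Fin.suc) nonempty)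
size-∖-< (false ∷ W) (false ∷ S) S⊆W nonempty = size-∖-< W S (S⊆W ∘ Fin.suc) nonempty

-- The empty set is singled out because in the recursion over S its term is the one that returns to
-- W itself.
∑-subsets-∅ : ∀ (W : Vec Bool n) F →
  ∑ (subsets W) F ≡ F (replicate n false) + ∑ (subsets W) (λ S → ⟦ not (isEmpty S) ⟧ * F S)
∑-subsets-∅ []          F = cong (F [] +_) (sym (trans (+-identityʳ _) (*-zeroˡ (F []))))
∑-subsets-∅ (false ∷ W) F = begin
  ∑ (subsets (false ∷ W)) F
    ≡⟨ ∑-subsets-false W F ⟩
  ∑ (subsets W) (λ S → F (false ∷ S))
    ≡⟨ ∑-subsets-∅ W (λ S → F (false ∷ S)) ⟩
  F (replicate _ false) + ∑ (subsets W) (λ S → ⟦ not (isEmpty S) ⟧ * F (false ∷ S))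
    ≡⟨ cong (F (replicate _ false) +_) (∑-subsets-false W (λ S → ⟦ not (isEmpty S) ⟧ * F S)) ⟨
  F (replicate _ false) + ∑ (subsets (false ∷ W)) (λ S → ⟦ not (isEmpty S) ⟧ * F S) ∎
∑-subsets-∅ (true ∷ W)  F = begin
  ∑ (subsets (true ∷ W)) F
    ≡⟨ ∑-subsets-true W F ⟩
  F₁ + ∑ (subsets W) (λ S → F (false ∷ S))
    ≡⟨ cong (F₁ +_) (∑-subsets-∅ W (λ S → F (false ∷ S))) ⟩
  F₁ + (F ∅ + ∑ (subsets W) (λ S → ⟦ not (isEmpty S) ⟧ * F (false ∷ S)))
    ≡⟨ solve 3 (λ a b c → a :+ (b :+ c) := b :+ (a :+ c)) refl F₁ (F ∅) _ ⟩
  F ∅ + (F₁ + ∑ (subsets W) (λ S → ⟦ not (isEmpty S) ⟧ * F (false ∷ S)))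
    ≡⟨ cong (λ f → F ∅ + (f + ∑ (subsets W) (λ S → ⟦ not (isEmpty S) ⟧ * F (false ∷ S))))
         (∑-cong (subsets W) (λ S → sym (*-identityˡ (F (true ∷ S))))) ⟩
  F ∅ + (∑ (subsets W) (λ S → 1ℚ * F (true ∷ S)) + ∑ (subsets W) (λ S → ⟦ not (isEmpty S) ⟧ * F (false ∷ S)))
    ≡⟨ cong (F ∅ +_) (∑-subsets-true W (λ S → ⟦ not (isEmpty S) ⟧ * F S)) ⟨
  F ∅ + ∑ (subsets (true ∷ W)) (λ S → ⟦ not (isEmpty S) ⟧ * F S) ∎
  where
  ∅ = replicate _ false
  F₁ = ∑ (subsets W) (λ S → F (true ∷ S))

module _ {n} (E : Digraph n) where

  -- The value at the k-th argument −1, 0, 1, … of the polynomial (−1)^|W| χ_W, where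
  -- χ_W is the chromatic polynomial of the subgraph induced on W.
  signedChromatic : Vec Bool n → ℕ → ℚ
  signedChromatic W zero    = acyclicCount E W
  signedChromatic W (suc k) = chromatic E (replicate k (- 1ℚ)) W

  -- One recursion covers the acyclic counts as well. At k = 0, coloring with no colors gives the
  -- indicator of W = ∅, which equals the sink identity at x = -1; for larger k the first color is
  -- peeled off.
  signedChromatic-suc : ∀ W k → signedChromatic W (suc k) ≡
    ∑ (subsets W) (λ S → ⟦ stable E S ⟧ * (- 1ℚ) ^^ S * signedChromatic (W ∖ S) k)
  signedChromatic-suc W zero    = trans (chromatic-[] E W)
    (trans (sym (acyclic-sinkless E W)) (sym (∑-stable-acyclic E (- 1ℚ) W)))
  signedChromatic-suc W (suc k) = chromatic-∷ E (- 1ℚ) (replicate k (- 1ℚ)) W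

  -- This is reciprocity. The term of S = ∅ in the recursion is `signedChromatic W k`, so the
  -- difference is a combination of the sequences of smaller sets, polynomial by induction on |W|.
  poly-signedChromatic : ∀ W → IsPolynomial (signedChromatic W)
  poly-signedChromatic W = go (suc (size W)) W ℕ.≤-refl
    where
    go : ∀ b W → size W < b → IsPolynomial (signedChromatic W)
    go (suc b) W (s≤s size≤b) = poly-Δ (signedChromatic W) (poly-cong difference (poly-∑ G (subsets W) poly))
      where
      F : Vec Bool n → ℕ → ℚ
      F S k = ⟦ stable E S ⟧ * (- 1ℚ) ^^ S * signedChromatic (W ∖ S) k
      G : Vec Bool n → ℕ → ℚ
      G S k = ⟦ not (isEmpty S) ⟧ * F S k
      poly : ∀ S → S ∈ˡ subsets W → IsPolynomial (G S)
      poly S S∈ with isEmpty S in eq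
      ... | true  = poly-cong (λ k → sym (*-zeroˡ (F S k))) poly-0
      ... | false = poly-*ˡ 1ℚ (poly-*ˡ (⟦ stable E S ⟧ * (- 1ℚ) ^^ S)
            (go b (W ∖ S) (ℕ.<-≤-trans (size-∖-< W S (∈-subsets⁻ W S∈) eq) size≤b)))
      ^^-∅ : ∀ n → (- 1ℚ) ^^ replicate n false ≡ 1ℚ
      ^^-∅ zero    = refl
      ^^-∅ (suc n) = ^^-∅ n
      stable-∅ : ∀ E → stable E (replicate n false) ≡ true
      stable-∅ []            = refl
      stable-∅ ((u , v) ∷ E) rewrite Vec.lookup-replicate u false = stable-∅ E
      ∖-∅ : ∀ {n} (W : Vec Bool n) → W ∖ replicate n false ≡ W
      ∖-∅ []      = refl
      ∖-∅ (w ∷ W) = cong₂ _∷_ (Bool.∧-identityʳ w) (∖-∅ W)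
      F-∅ : ∀ k → F (replicate n false) k ≡ signedChromatic W k
      F-∅ k = trans
        (cong₂ _*_ (cong₂ (λ b x → ⟦ b ⟧ * x) (stable-∅ E) (^^-∅ n)) (cong (λ W → signedChromatic W k) (∖-∅ W)))
        (*-identityˡ (signedChromatic W k))
      difference : ∀ k → ∑ (subsets W) (λ S → G S k) ≡ Δ (signedChromatic W) k
      difference k = begin
        ∑ (subsets W) (λ S → G S k)
          ≡⟨ solve 2 (λ a b → b := (a :+ b) :- a) refl (signedChromatic W k) _ ⟩
        signedChromatic W k + ∑ (subsets W) (λ S → G S k) - signedChromatic W k
          ≡⟨ cong (λ s → s + ∑ (subsets W) (λ S → G S k) - signedChromatic W k) (F-∅ k) ⟨
        F (replicate n false) k + ∑ (subsets W) (λ S → G S k) - signedChromatic W k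
          ≡⟨ cong (_- signedChromatic W k) (trans (signedChromatic-suc W k) (∑-subsets-∅ W (λ S → F S k))) ⟨
        Δ (signedChromatic W) k ∎

-- Graphs

count : Vec Bool n → ℕ
count []          = 0
count (true ∷ B)  = suc (count B)
count (false ∷ B) = count B

sinkProduct-full : ∀ x (B : Vec Bool n) → sinkProduct x (replicate n true) B ≡ (1ℚ + x) ^ count B
sinkProduct-full x []          = refl
sinkProduct-full x (true ∷ B)  = cong ((1ℚ + x) *_) (sinkProduct-full x B)
sinkProduct-full x (false ∷ B) = trans (*-identityˡ _) (sinkProduct-full x B)

does-true⁻ : ∀ {P : Set} (P? : Dec P) → does P? ≡ true → P
does-true⁻ (yes p) _ = p

length-filter-tabulate : ∀ {P : A → Set} (P? : ∀ x → Dec (P x)) (f : Fin n → A) →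
  length (filter P? (List.tabulate f)) ≡ count (tabulate (λ i → does (P? (f i))))
length-filter-tabulate {n = zero}  P? f = refl
length-filter-tabulate {n = suc n} P? f with does (P? (f Fin.zero))
... | true  = cong suc (length-filter-tabulate P? (f ∘ Fin.suc))
... | false = length-filter-tabulate P? (f ∘ Fin.suc)

module _ (G : Graph) where
  open Graph G

  edgeList : Digraph order
  edgeList = Vec.toList edges

  does-proper : ∀ (κ : Coloring G m) → does (proper? G κ) ≡ properᵇ edgeList κ
  does-proper κ = go edges
    where
    go : ∀ {k} (es : Vec (Vertex G × Vertex G) k) →
         does (VecAll.all? (λ (u , v) → ¬? (lookup κ u Fin.≟ lookup κ v)) es) ≡ properᵇ (Vec.toList es) κ
    go []             = refl
    go ((u , v) ∷ es) = cong (not (does (lookup κ u Fin.≟ lookup κ v)) ∧_) (go es)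

  -- Every vertex has weight 1, stored as 0.
  content-weight : ∀ (κ : Coloring G m) → content G κ ≡ weight (replicate order 0) κ
  content-weight κ = go κ
    where
    go : ∀ {m n} (κ : Vec (Fin m) n) → tabulate (λ c → Vec.count (Fin._≟ c) κ) ≡ weight (replicate n 0) κ
    go {m} []      = trans (Vec.tabulate-cong (λ c → sym (Vec.lookup-replicate c 0))) (Vec.tabulate∘lookup (replicate m 0))
    go {m} {suc n} (c ∷ κ) = trans (Vec.tabulate-cong count-∷) (Vec.tabulate∘lookup (unit c 1 ⊞ weight (replicate n 0) κ))
      where
      lookup-weight : ∀ d → lookup (weight (replicate n 0) κ) d ≡ Vec.count (Fin._≟ d) κ
      lookup-weight d = trans (cong (λ w → lookup w d) (sym (go κ))) (Vec.lookup∘tabulate (λ c → Vec.count (Fin._≟ c) κ) d)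
      count-∷ : ∀ d → Vec.count (Fin._≟ d) (c ∷ κ) ≡ lookup (unit c 1 ⊞ weight (replicate n 0) κ) d
      count-∷ d rewrite Vec.lookup-zipWith ℕ._+_ d (unit c 1) (weight (replicate n 0) κ) | lookup-weight d with c Fin.≟ d
      ... | yes refl rewrite Vec.lookup∘update c (replicate m 0) 1 = refl
      ... | no c≢d   rewrite Vec.lookup∘update′ (λ d≡c → c≢d (sym d≡c)) (replicate m 0) 1 | Vec.lookup-replicate d 0 = refl

  X-colorSeries : X G ≈ colorSeries (replicate order 0) edgeList
  X-colorSeries m e = trans (length-filter _ (allVecs (allFin m) order)) (∑-cong (allVecs (allFin m) order) (λ κ →
    trans (⟦∧⟧ (does (proper? G κ)) _)
          (cong₂ (λ b α → ⟦ b ⟧ * δ α e) (does-proper κ) (content-weight κ))))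

  digraph : Orientation G → Digraph order
  digraph o = Vec.toList (zipWith (orient G) o edges)

  ∑-orientations : ∀ h → ∑ (orientations G) (h ∘ digraph) ≡ ∑ (orientationsOf edgeList) h
  ∑-orientations h = go edges h
    where
    go : ∀ {k} (es : Vec (Vertex G × Vertex G) k) h →
         ∑ (allVecs (true ∷ false ∷ []) k) (λ o → h (Vec.toList (zipWith (orient G) o es))) ≡
         ∑ (orientationsOf (Vec.toList es)) h
    go []             h = refl
    go {suc k} ((u , v) ∷ es) h = begin
      ∑ (allVecs (true ∷ false ∷ []) (suc k)) (λ o → h (Vec.toList (zipWith (orient G) o ((u , v) ∷ es))))
        ≡⟨ ∑-cartesian (λ o → h (Vec.toList (zipWith (orient G) o ((u , v) ∷ es)))) _∷_ (true ∷ false ∷ []) os ⟩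
      ∑ os (λ o → h ((u , v) ∷ Vec.toList (zipWith (orient G) o es))) +
      (∑ os (λ o → h ((v , u) ∷ Vec.toList (zipWith (orient G) o es))) + 0ℚ)
        ≡⟨ cong₂ _+_ (go es (λ D → h ((u , v) ∷ D))) (trans (+-identityʳ _) (go es (λ D → h ((v , u) ∷ D)))) ⟩
      ∑ (orientationsOf (Vec.toList es)) (λ D → h ((u , v) ∷ D)) + ∑ (orientationsOf (Vec.toList es)) (λ D → h ((v , u) ∷ D))
        ≡⟨ ∑-orientations-∷ u v (Vec.toList es) h ⟨
      ∑ (orientationsOf (Vec.toList ((u , v) ∷ es))) h ∎
      where os = allVecs (true ∷ false ∷ []) k

  arrow⁺ : ∀ o {u v} → Arrow G o u v → u ⟶⟨ digraph o ⟩ v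
  arrow⁺ o = VecMembership.∈-toList⁺

  arrow⁻ : ∀ o {u v} → u ⟶⟨ digraph o ⟩ v → Arrow G o u v
  arrow⁻ o = VecMembership.∈-toList⁻

  does-acyclic : ∀ o → does (acyclic? G o) ≡ acyclicᵇ (digraph o)
  does-acyclic o = does-⇔ (mk⇔
    (λ ac v cyc → ac v (plus-map (arrow⁻ o) cyc))
    (λ ac v cyc → ac v (plus-map (arrow⁺ o) cyc))) (acyclic? G o) (isAcyclic? (digraph o))

  does-sink : ∀ o v → does (sink? G o v) ≡ sinkᵇ (digraph o) v
  does-sink o v = bool-ext
    (λ sink → all⁺ _ (digraph o) (λ (a , b) ab∈ → cong not (dec-false (a Fin.≟ v)
      (λ { refl → does-true⁻ (sink? G o v) sink b (arrow⁻ o ab∈) }))))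
    (λ sink → dec-true (sink? G o v) (λ b vb∈ →
      Bool.not-¬ (all⁻ _ (digraph o) sink _ (arrow⁺ o vb∈)) (cong not (dec-true (v Fin.≟ v) refl))))

  sinkCount-count : ∀ o → sinkCount G o ≡ count (sinkVec (digraph o))
  sinkCount-count o = trans (length-filter-tabulate (sink? G o) id)
    (cong count (Vec.tabulate-cong (does-sink o)))

  -- The generating polynomial of acyclic orientations with t marking sinks; an orientation with a
  -- cycle stays in the list with coefficient 0.
  acyclicSinks : List (ℚ × ℕ)
  acyclicSinks = map (λ o → ⟦ does (acyclic? G o) ⟧ , sinkCount G o) (orientations G)

  acyclicWithSinks-coefficient : ∀ k → fromℕ (acyclicWithSinks G k) ≡ coefficientAt k acyclicSinks
  acyclicWithSinks-coefficient k = trans (length-filter _ (orientations G))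
    (trans (∑-cong (orientations G) (λ o → ⟦∧⟧ (does (acyclic? G o)) _)) (sym (∑-map _ _ (orientations G))))

  full : Vec Bool order
  full = replicate order true

  -- The right side is the expression in `value-X` with index 0 in place of `suc m`, so that both
  -- belong to one sequence.
  powerSum-acyclicSinks : ∀ x → powerSum acyclicSinks (1ℚ + x) ≡
    ∑ (subsets full) (λ S → ⟦ stable edgeList S ⟧ * x ^^ S * signedChromatic edgeList (full ∖ S) 0)
  powerSum-acyclicSinks x = begin
    powerSum acyclicSinks (1ℚ + x)
      ≡⟨ ∑-map _ _ (orientations G) ⟩
    ∑ (orientations G) (λ o → ⟦ does (acyclic? G o) ⟧ * (1ℚ + x) ^ sinkCount G o)
      ≡⟨ ∑-cong (orientations G) (λ o → cong₂ (λ b r → ⟦ b ⟧ * r) (does-acyclic o)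
           (trans (cong ((1ℚ + x) ^_) (sinkCount-count o)) (sym (sinkProduct-full x (sinkVec (digraph o)))))) ⟩
    ∑ (orientations G) (λ o → ⟦ acyclicᵇ (digraph o) ⟧ * sinkProduct x full (sinkVec (digraph o)))
      ≡⟨ ∑-orientations (λ D → ⟦ acyclicᵇ D ⟧ * sinkProduct x full (sinkVec D)) ⟩
    ∑ (orientationsOf edgeList) (λ D → ⟦ acyclicᵇ D ⟧ * sinkProduct x full (sinkVec D))
      ≡⟨ cong (λ F → ∑ (orientationsOf F) (λ D → ⟦ acyclicᵇ D ⟧ * sinkProduct x full (sinkVec D))) (inside-full edgeList) ⟨
    ∑ (orientationsOf (filterᵇ (inside full) edgeList)) (λ D → ⟦ acyclicᵇ D ⟧ * sinkProduct x full (sinkVec D))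
      ≡⟨ ∑-stable-acyclic edgeList x full ⟨
    ∑ (subsets full) (λ S → ⟦ stable edgeList S ⟧ * x ^^ S * signedChromatic edgeList (full ∖ S) 0) ∎
    where
    inside-full : ∀ E → filterᵇ (inside full) E ≡ E
    inside-full []            = refl
    inside-full ((u , v) ∷ E) rewrite Vec.lookup-replicate u true | Vec.lookup-replicate v true =
      cong ((u , v) ∷_) (inside-full E)

  -- The class S receives the color of value x, and the m colors of value -1 are left for its
  -- complement.
  value-X : ∀ x m → HasValue (X G) (special x m)
    (∑ (subsets full) (λ S → ⟦ stable edgeList S ⟧ * x ^^ S * signedChromatic edgeList (full ∖ S) (suc m)))
  value-X x m = hasValue (colorTerms (replicate order 0) edgeList (suc m))
    (λ e → trans (X-colorSeries (suc m) e) (color-coefficient (replicate order 0) edgeList (suc m) e))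
    (trans (∑-map _ _ (allVecs (allFin (suc m)) order))
      (trans (sym (chromatic-full edgeList (special x m))) (chromatic-∷ edgeList x (replicate m (- 1ℚ)) full)))

  -- For fixed x, the two values of X_G are polynomials in k = m + 1 that agree for k ≥ 1; the claim
  -- is their agreement at k = 0.
  acyclicSinks-polynomialAt : ∀ P → X G ≈ eval P → ∀ x → powerSum acyclicSinks (1ℚ + x) ≡ polynomialAt (1ℚ + x) 0ℚ P
  acyclicSinks-polynomialAt P X≈P x = trans (powerSum-acyclicSinks x) (agree-at-0
    (poly-∑ _ (subsets full) (λ S _ → poly-*ˡ (⟦ stable edgeList S ⟧ * x ^^ S) (poly-signedChromatic edgeList (full ∖ S))))
    (poly-polynomialAt (1ℚ + x) P)
    (λ m → value-unique X≈P (value-X x m) (value-eval x m P)))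

  -- Both sides are coefficients of tᵏ in polynomials that agree at every natural number t = n, as
  -- taking x = n - 1 shows.
  acyclicWithSinks-coefficientSum : ∀ P → X G ≈ eval P → ∀ k → fromℕ (acyclicWithSinks G k) ≡ coefficientSum k P
  acyclicWithSinks-coefficientSum P X≈P k = begin
    fromℕ (acyclicWithSinks G k)    ≡⟨ acyclicWithSinks-coefficient k ⟩
    coefficientAt k acyclicSinks    ≡⟨ coefficients-equal acyclicSinks degrees same-powerSum k ⟩
    coefficientAt k degrees         ≡⟨ trans (∑-map _ _ P) (∑-cong P (λ (c , μ) → *-comm c ⟦ does (indexSum μ ℕ.≟ k) ⟧)) ⟩
    ∑ P (λ (c , μ) → ⟦ does (indexSum μ ℕ.≟ k) ⟧ * c) ≡⟨ ∑-filter (λ (c , μ) → indexSum μ ℕ.≟ k) proj₁ P ⟨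
    coefficientSum k P              ∎
    where
    degrees = map (λ (c , μ) → c , indexSum μ) P
    same-powerSum : ∀ n → powerSum acyclicSinks (fromℕ n) ≡ powerSum degrees (fromℕ n)
    same-powerSum n = begin
      powerSum acyclicSinks (fromℕ n)                 ≡⟨ cong (powerSum acyclicSinks) t≡ ⟩
      powerSum acyclicSinks (1ℚ + (fromℕ n - 1ℚ))     ≡⟨ acyclicSinks-polynomialAt P X≈P (fromℕ n - 1ℚ) ⟩
      polynomialAt (1ℚ + (fromℕ n - 1ℚ)) 0ℚ P         ≡⟨ cong (λ t → polynomialAt t 0ℚ P) t≡ ⟨
      polynomialAt (fromℕ n) 0ℚ P                     ≡⟨ polynomialAt-0 (fromℕ n) P ⟩
      ∑ P (λ (c , μ) → c * fromℕ n ^ indexSum μ)      ≡⟨ ∑-map _ _ P ⟨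
      powerSum degrees (fromℕ n)                      ∎
      where
      t≡ : fromℕ n ≡ 1ℚ + (fromℕ n - 1ℚ)
      t≡ = solve 1 (λ t → t := con 1ℚ :+ (t :- con 1ℚ)) refl (fromℕ n)

theorem3p7 : (G : Graph) →
    (∃[ P ] X G ≈ eval P) ×
    ((P : Polynomial) → X G ≈ eval P →
    (k : ℕ) → fromℕ (acyclicWithSinks G k) ≡ coefficientSum k P)
theorem3p7 G = (polynomial , expresses) , acyclicWithSinks-coefficientSum G
  where
  open Expressible (expressible-≈ (X-colorSeries G)
    (expressible-color (Graph.order G) (replicate (Graph.order G) 0) (edgeList G)))
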